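{- Let $m\ge 1$ be an integer, $M=2^m$, and let $G=(V,E)$ be an undirected graph with vertex set $V=\{1,\dots,n\}$, $n \geq 1$, whose edge costs are integers in $\{1,2,\dots,M\}$. Let $\mathbf D=(d_{ij})$ be its $n\times n$ cost matrix: $d_{ij}$ is the cost of edge $(i,j)$ if $(i,j)\in E$, $d_{ii}=0$, and $d_{ij}=+\infty$ otherwise. Then the revised Shoshan-Zwick algorithm (defined in the context), run on $\mathbf D$, returns a matrix $\Delta$ with $$\Delta_{ij}=\delta(i,j)\qquad\text{for all } 1\le i,j\le n,$$ where $\delta(i,j)$ denotes the cost of a shortest path between $i$ and $j$ in $G$ (with $\delta(i,j)=+\infty$ if there is no such path).
   Context: All matrices are $n\times n$ with entries in $\mathbb Z\cup\{+\infty\}$, with the usual conventions: $+\infty$ plus or minus an integer is $+\infty$, $+\infty+\infty=+\infty$, and $+\infty$ is larger than every integer (so $+\infty\ge 0$ holds). Operations (for matrices $\mathbf A=(a_{ij})$, $\mathbf B=(b_{ij})$ and integers $a\le b$): - Distance product: $(\mathbf A\star\mathbf B)_{ij}=\min_{1\le k\le n}\{a_{ik}+b_{kj}\}$. - $(\mathrm{clip}(\mathbf A,a,b))_{ij}=a$ if $a_{ij}<a$; $=a_{ij}$ if $a\le a_{ij}\le b$; $=+\infty$ if $a_{ij}>b$. - $(\mathrm{chop}(\mathbf A,a,b))_{ij}=a_{ij}$ if $a\le a_{ij}\le b$; $=+\infty$ otherwise. - $(\mathbf A\bigwedge\mathbf B)_{ij}=a_{ij}$ if $b_{ij}<0$;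 $=+\infty$ otherwise. - $(\mathbf A\bar{\bigwedge}\mathbf B)_{ij}=a_{ij}$ if $b_{ij}\ge 0$; $=+\infty$ otherwise. - $(\mathbf A\bigvee\mathbf B)_{ij}=a_{ij}$ if $a_{ij}\ne+\infty$; $=b_{ij}$ if $a_{ij}=+\infty$. - For a condition on entries, such as $(\mathbf C\ge 0)$ or $(-M<\mathbf P<0)$, the corresponding Boolean matrix has $(i,j)$ entry $1$ if the $(i,j)$ entry of the matrix satisfies the condition and $0$ otherwise. - $\mathbf D-M$ denotes subtracting $M$ from each entry; "$\mathbf C=-M$" and "$\mathbf Q=+\infty$" denote constant matrices. Revised Shoshan-Zwick algorithm on input $\mathbf D$ (with $M=2^m$): 1. Set $l=\lceil\log_2 n\rceil$ and $m=\log_2 M$. 2. Repeat $m+1$ times: $\mathbf D:=\mathrm{clip}(\mathbf D\star\mathbf D,0,2M)$. 3. $\mathbf A_0:=\mathbf D-M$. For $k=1,\dots,l$: $\mathbf A_k:=\mathrm{clip}(\mathbf A_{k-1}\star\mathbf A_{k-1},-M,M)$. 4. $\mathbf C_l:=-M$; $\mathbf P_l:=\mathrm{clip}(\mathbf D,0,M)$; $\mathbf Q_l:=+\infty$. 5. For $k=l-1$ down to $0$: $\mathbf C_k:=[\mathrm{clip}(\mathbf P_{k+1}\star\mathbf A_k,-M,M)\bigwedge\mathbf C_{k+1}]\bigvee[\mathrm{clip}(\mathbf Q_{k+1}\star\mathbf A_k,-M,M)\bar{\bigwedge}\mathbf C_{k+1}]$; $\mathbf P_k:=\mathbf P_{k+1}\bigvee\mathbf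 Q_{k+1}$; $\mathbf Q_k:=\mathrm{chop}(\mathbf C_k,1-M,M)$. 6. For $k=1,\dots,l$: $\mathbf B_k:=(\mathbf C_k\ge 0)$. 7. $\hat{\mathbf B}_0:=(-M<\mathbf P_0<0)$; $\hat{\mathbf R}:=\mathbf P_0$. 8. Return $\Delta:=M\cdot\sum_{k=1}^{l}2^k\cdot\mathbf B_k+2\cdot M\cdot\hat{\mathbf B}_0+\hat{\mathbf R}$. -}

module Defs where

open import Algebra.Properties.CommutativeMonoid.Sum as Sum using ()
open import Data.Bool.Base using (if_then_else_; _∧_)
open import Data.Fin.Base using (Fin; toℕ)
open import Data.Fin.Properties as Fin using ()
open import Data.Integer.Base using (ℤ; +_; -_; _+_; _-_; _*_; _≤_; _<_; 0ℤ; 1ℤ)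
open import Data.Integer.Properties as ℤ using ()
open import Data.List.Base using (List; []; _∷_)
open import Data.List.Relation.Unary.Unique.Propositional using (Unique)
open import Data.Nat.Base using (ℕ; zero; suc; _^_; _∸_)
open import Data.Nat.GeneralisedArithmetic using (fold)
open import Data.Nat.Logarithm using (⌈log₂_⌉)
open import Data.Product.Base using (Σ-syntax; _×_; _,_)
open import Data.Vec.Functional using (foldr)
open import Level using (0ℓ)
open import Relation.Binary.Bundles using (TotalOrder)
open import Relation.Binary.Construct.Add.Supremum.NonStrict _≤_ using (_≤⁺_; ≤⁺-dec; ≤⁺-isTotalOrder-≡)
open import Relation.Binary.Construct.Add.Supremum.Strict _<_ using (_<⁺_; <⁺-dec)
open import Relation.Binary.Construct.Closure.ReflexiveTransitive using (Star; ε; _◅_)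
open import Relation.Binary.Core using (Rel)
open import Relation.Binary.Definitions using (Decidable; Symmetric)
open import Relation.Binary.PropositionalEquality.Core using (_≡_)
open import Relation.Nullary.Construct.Add.Supremum using (_⁺; ⊤⁺; [_])
open import Relation.Nullary.Decidable.Core using (does)
open import Relation.Nullary.Negation.Core using (¬_)

ℤ∞ : Set
ℤ∞ = ℤ ⁺

infixl 6 _+∞_

_+∞_ : ℤ∞ → ℤ∞ → ℤ∞
[ x ] +∞ [ y ] = [ x + y ]
[ _ ] +∞ ⊤⁺    = ⊤⁺
⊤⁺    +∞ _     = ⊤⁺

infix 4 _≤?_ _<?_

_≤?_ : Decidable _≤⁺_
_≤?_ = ≤⁺-dec ℤ._≤?_

_<?_ : Decidable _<⁺_
_<?_ = <⁺-dec ℤ._<?_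

≤⁺-totalOrder : TotalOrder 0ℓ 0ℓ 0ℓ
≤⁺-totalOrder = record { isTotalOrder = ≤⁺-isTotalOrder-≡ ℤ.≤-isTotalOrder }

open import Algebra.Construct.NaturalChoice.Min ≤⁺-totalOrder public using (_⊓_)

Matrix : ℕ → Set
Matrix n = Fin n → Fin n → ℤ∞

module _ {n : ℕ} where

  infixl 7 _⋆_ _⋀_ _⋀̄_
  infixl 6 _⋁_ _-ᴹ_

  const : ℤ∞ → Matrix n
  const x _ _ = x

  _⋆_ : Matrix n → Matrix n → Matrix n
  (A ⋆ B) i j = foldr _⊓_ ⊤⁺ λ k → A i k +∞ B k j

  clip : Matrix n → ℤ → ℤ → Matrix n
  clip A a b i j =
    if does (A i j <? [ a ]) then [ a ] else
    if does (A i j ≤? [ b ]) then A i j else ⊤⁺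

  chop : Matrix n → ℤ → ℤ → Matrix n
  chop A a b i j =
    if does ([ a ] ≤? A i j) ∧ does (A i j ≤? [ b ]) then A i j else ⊤⁺

  _⋀_ : Matrix n → Matrix n → Matrix n
  (A ⋀ B) i j = if does (B i j <? [ 0ℤ ]) then A i j else ⊤⁺

  _⋀̄_ : Matrix n → Matrix n → Matrix n
  (A ⋀̄ B) i j = if does ([ 0ℤ ] ≤? B i j) then A i j else ⊤⁺

  orElse : ℤ∞ → ℤ∞ → ℤ∞
  orElse [ x ] _ = [ x ]
  orElse ⊤⁺    y = y

  _⋁_ : Matrix n → Matrix n → Matrix n
  (A ⋁ B) i j = orElse (A i j) (B i j)

  _-ᴹ_ : Matrix n → ℤ → Matrix n
  (A -ᴹ c) i j = A i j +∞ [ - c ]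

  -- Boolean matrices are valued in {0, 1} ⊆ ℤ, as they enter the output
  -- arithmetically.
  BooleanMatrix : Set
  BooleanMatrix = Fin n → Fin n → ℤ

  nonNegative : Matrix n → BooleanMatrix
  nonNegative A i j = if does ([ 0ℤ ] ≤? A i j) then 1ℤ else 0ℤ

  strictlyBetween : ℤ → Matrix n → ℤ → BooleanMatrix
  strictlyBetween a A b i j =
    if does ([ a ] <? A i j) ∧ does (A i j <? [ b ]) then 1ℤ else 0ℤ

open Sum ℤ.+-0-commutativeMonoid using (sum-syntax)

module ShoshanZwick {n : ℕ} (m : ℕ) (input : Matrix n) where

  M : ℤ
  M = + (2 ^ m)

  l : ℕ
  l = ⌈log₂ n ⌉

  D : Matrix n
  D = fold input (λ X → clip (X ⋆ X) 0ℤ (+ 2 * M)) (suc m)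

  A : ℕ → Matrix n
  A zero    = D -ᴹ M
  A (suc k) = clip (A k ⋆ A k) (- M) M

  record State : Set where
    constructor state
    field
      C P Q : Matrix n

  initial : State
  initial = state (const [ - M ]) (clip D 0ℤ M) (const ⊤⁺)

  -- From (C (k + 1) , P (k + 1) , Q (k + 1)) to (C k , P k , Q k).
  step : ℕ → State → State
  step k (state C P Q) = state C′ (P ⋁ Q) (chop C′ (1ℤ - M) M)
    where
    C′ : Matrix n
    C′ = (clip (P ⋆ A k) (- M) M ⋀ C) ⋁ (clip (Q ⋆ A k) (- M) M ⋀̄ C)

  -- The state after t rounds of the descending loop, i.e. at k = l - t.
  after : ℕ → State
  after zero    = initial
  after (suc t) = step (l ∸ suc t) (after t)

  -- Meaningful for k ≤ l.
  C P Q : ℕ → Matrix n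
  C k = State.C (after (l ∸ k))
  P k = State.P (after (l ∸ k))
  Q k = State.Q (after (l ∸ k))

  B : ℕ → BooleanMatrix
  B k = nonNegative (C k)

  B̂₀ : BooleanMatrix
  B̂₀ = strictlyBetween (- M) (P 0) 0ℤ

  R̂ : Matrix n
  R̂ = P 0

  -- The summation index t < l stands for k = t + 1, so that 1 ≤ k ≤ l.
  Δ : Matrix n
  Δ i j =
    [ M * (∑[ t < l ] (+ (2 ^ suc (toℕ t)) * B (suc (toℕ t)) i j))
      + + 2 * M * B̂₀ i j ]
    +∞ R̂ i j

revisedShoshanZwick : ∀ {n} → ℕ → Matrix n → Matrix n
revisedShoshanZwick m input = ShoshanZwick.Δ m input

record Graph (n : ℕ) : Set₁ where
  field
    Edge      : Rel (Fin n) 0ℓ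
    edge?     : Decidable Edge
    symmetric : Symmetric Edge
    loopless  : ∀ {i} → ¬ Edge i i
    -- Only the values on edges are meaningful.
    cost      : Fin n → Fin n → ℤ
    cost-sym  : ∀ {i j} → Edge i j → cost i j ≡ cost j i

  costMatrix : Matrix n
  costMatrix i j =
    if does (i Fin.≟ j) then [ 0ℤ ] else
    if does (edge? i j) then [ cost i j ] else ⊤⁺

  Walk : Rel (Fin n) 0ℓ
  Walk = Star Edge

  vertices : ∀ {i j} → Walk i j → List (Fin n)
  vertices {i} ε       = i ∷ []
  vertices {i} (_ ◅ w) = i ∷ vertices w

  walkCost : ∀ {i j} → Walk i j → ℤ
  walkCost ε                         = 0ℤ
  walkCost (_◅_ {i = i} {j = j} _ w) = cost i j + walkCost w

  -- Vertices of a path are distinct; the path from i to itself has cost 0.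
  Path : Rel (Fin n) 0ℓ
  Path i j = Σ[ w ∈ Walk i j ] Unique (vertices w)

  pathCost : ∀ {i j} → Path i j → ℤ
  pathCost (w , _) = walkCost w

  -- The relation x = δ(i , j); at most one x satisfies it.
  IsDistance : Fin n → Fin n → ℤ∞ → Set
  IsDistance i j ⊤⁺    = ¬ Path i j
  IsDistance i j [ c ] = (Σ[ p ∈ Path i j ] pathCost p ≡ c)
                       × (∀ (p : Path i j) → c ≤ pathCost p)

{-# OPTIONS --safe #-}
module Submission where

-- Write K = 2 ^ k * M.  The entries of A k are δ(i, j) - K clipped to [-M, M].  In the
-- descending loop, P k and Q k hold the offset of δ(i, j) from a multiple of 2K, respectively
-- an odd multiple of K, whenever this offset lies in (-M, M], and C k is the remainder of
-- δ(i, j) modulo 2K, minus K and clipped.  Hence the sign of C k is a binary digit of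
-- ⌊δ(i, j) / M⌋, P 0 is the offset from the nearest multiple of 2M, and Δ reassembles δ.
-- The distance products are bounded above because edges cost at most M, so that a shortest
-- path has a vertex in every window of M consecutive costs.  They are bounded below by the
-- triangle inequality, once its symmetric form has excluded the intermediate vertices whose
-- offset is taken from a multiple beyond δ(i, j).

open import Algebra.Construct.NaturalChoice.Min using (minOperator)
open import Algebra.Properties.CommutativeMonoid.Sum as Sum using ()
open import Data.Bool.Base using (true; false; if_then_else_; _∧_)
open import Data.Bool.Properties using (∧-zeroʳ)
open import Data.Empty using (⊥; ⊥-elim)
open import Data.Fin.Base using (Fin; zero; suc; toℕ)
open import Data.Fin.Properties as Fin using ()
open import Data.Integer.Base as ℤ using (ℤ; +_; -_; _+_; _-_; _*_; _≤_; 0ℤ; 1ℤ; +≤+)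
open import Data.Integer.Properties as ℤ using ()
open import Data.Integer.Tactic.RingSolver using (solve)
open import Data.List.Base using (List; []; _∷_; length; lookup)
open import Data.List.Membership.Propositional using (_∈_)
open import Data.List.Membership.Propositional.Properties using (∈-lookup)
open import Data.List.Relation.Unary.All as All using ()
open import Data.List.Relation.Unary.All.Properties using (¬Any⇒All¬)
open import Data.List.Relation.Unary.AllPairs using ([]; _∷_)
open import Data.List.Relation.Unary.Any using (here; there)
open import Data.List.Relation.Unary.Unique.Propositional using (Unique)
open import Data.Nat.Base as ℕ using (ℕ; zero; suc; _^_; _∸_; z≤n; s≤s; ⌈_/2⌉)
open import Data.Nat.DivMod using (_/_; _%_; m≡m%n+[m/n]*n; m%n<n)
open import Data.Nat.GeneralisedArithmetic using (fold)
open import Data.Nat.Induction using (Acc; acc; <-wellFounded)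
open import Data.Nat.Logarithm using (⌈log₂_⌉)
open import Data.Nat.Logarithm.Core using (⌈log2⌉)
open import Data.Nat.Properties as ℕ using ()
open import Data.Product.Base using (∃-syntax; Σ-syntax; _×_; _,_; proj₁; proj₂)
open import Data.Sum.Base using (_⊎_; inj₁; inj₂)
open import Data.Vec.Functional using (foldr)
open import Function.Base using (_∘_)
open import Relation.Binary.Construct.Add.Supremum.NonStrict _≤_ using (_≤⁺_; [_]; ≤⁺-trans)
open import Relation.Binary.Construct.Closure.ReflexiveTransitive using (ε; _◅_; _◅◅_)
open import Relation.Binary.PropositionalEquality
  using (_≡_; _≢_; refl; sym; trans; cong; cong₂; subst; module ≡-Reasoning)
open import Relation.Nullary.Construct.Add.Supremum using (⊤⁺; [_]; []-injective)
open import Relation.Nullary.Decidable using (yes; no; does; dec-true; dec-false)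
open import Relation.Nullary.Negation using (¬_; contradiction)
open import Defs
open import Algebra.Construct.NaturalChoice.MinOp (minOperator ≤⁺-totalOrder)
  using (⊓-sel; x⊓y≤x; x⊓y≤y)
open Sum ℤ.+-0-commutativeMonoid using (sum-syntax)

-- Linear arithmetic over the integers

infixl 6 _⊕_
_⊕_ : ∀ {a b c d} → a ≤ b → c ≤ d → a + c ≤ b + d
_⊕_ = ℤ.+-mono-≤

-- Linear arithmetic: a′ ≤ b′ is a sum of hypotheses with the same slack as the goal a ≤ b,
-- and the identity between the slacks is left to the ring solver.
lin : ∀ {a b a′ b′} → a′ ≤ b′ → b - a ≡ b′ - a′ → a ≤ b
lin h e = ℤ.0≤i-j⇒j≤i (subst (0ℤ ≤_) (sym e) (ℤ.i≤j⇒0≤j-i h))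

-- The same device for contradictions: hypotheses whose sum has slack `- 1ℤ` cannot all hold.
lin-⊥ : ∀ {a b} → a ≤ b → b - a ≡ - 1ℤ → ⊥
lin-⊥ h e with subst (0ℤ ≤_) e (ℤ.i≤j⇒0≤j-i h)
... | ()

≰⇒suc≤ : ∀ {a b} → ¬ a ≤ b → 1ℤ + b ≤ a
≰⇒suc≤ a≰b = ℤ.i<j⇒suc[i]≤j (ℤ.≰⇒> a≰b)

suc≤⇒≰ : ∀ {a b} → 1ℤ + b ≤ a → ¬ a ≤ b
suc≤⇒≰ b<a = ℤ.<⇒≱ (ℤ.suc[i]≤j⇒i<j b<a)

≤-cases : ∀ a b → a ≤ b ⊎ 1ℤ + b ≤ a
≤-cases a b with a ℤ.≤? b
... | yes a≤b = inj₁ a≤b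
... | no  a≰b = inj₂ (≰⇒suc≤ a≰b)

≡[]⇒≢⊤ : ∀ {x : ℤ} {y : ℤ∞} → y ≡ [ x ] → y ≢ ⊤⁺
≡[]⇒≢⊤ refl ()

[]-unique : ∀ {x y : ℤ} {z : ℤ∞} → z ≡ [ x ] → z ≡ [ y ] → x ≡ y
[]-unique p q = []-injective (trans (sym p) q)

-- Clipping and chopping of a single entry

clip∞ : ℤ → ℤ → ℤ∞ → ℤ∞
clip∞ a b x =
  if does (x <? [ a ]) then [ a ] else
  if does (x ≤? [ b ]) then x else ⊤⁺

chop∞ : ℤ → ℤ → ℤ∞ → ℤ∞
chop∞ a b x = if does ([ a ] ≤? x) ∧ does (x ≤? [ b ]) then x else ⊤⁺

module _ {a b x : ℤ} where

  clip-≤ : a ≤ b → x ≤ a → clip∞ a b [ x ] ≡ [ a ]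
  clip-≤ a≤b x≤a with x ℤ.<? a
  ... | yes _ = refl
  ... | no  a≤x with ℤ.≤-antisym x≤a (ℤ.≮⇒≥ a≤x)
  ...   | refl rewrite dec-true (x ℤ.≤? b) a≤b = refl

  clip-mid : a ≤ x → x ≤ b → clip∞ a b [ x ] ≡ [ x ]
  clip-mid a≤x x≤b
    rewrite dec-false (x ℤ.<? a) (ℤ.≤⇒≯ a≤x) | dec-true (x ℤ.≤? b) x≤b = refl

  clip-> : a ≤ b → 1ℤ + b ≤ x → clip∞ a b [ x ] ≡ ⊤⁺
  clip-> a≤b b<x
    rewrite dec-false (x ℤ.<? a) (λ x<a → suc≤⇒≰ b<x (ℤ.≤-trans (ℤ.<⇒≤ x<a) a≤b))
          | dec-false (x ℤ.≤? b) (suc≤⇒≰ b<x) = refl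

  chop-mid : a ≤ x → x ≤ b → chop∞ a b [ x ] ≡ [ x ]
  chop-mid a≤x x≤b rewrite dec-true (a ℤ.≤? x) a≤x | dec-true (x ℤ.≤? b) x≤b = refl

clip-inv : ∀ {a b x} z → clip∞ a b z ≡ [ x ] →
           ∃[ y ] z ≡ [ y ] × ((y ≤ a × x ≡ a) ⊎ (a ≤ y × y ≤ b × x ≡ y))
clip-inv {a} {b} [ y ] e with y ℤ.<? a
... | yes y<a = y , refl , inj₁ (ℤ.<⇒≤ y<a , sym ([]-injective e))
... | no  y≮a with y ℤ.≤? b
...   | yes y≤b = y , refl , inj₂ (ℤ.≮⇒≥ y≮a , y≤b , sym ([]-injective e))
clip-inv ⊤⁺ ()

chop-inv : ∀ {a b x} z → chop∞ a b z ≡ [ x ] → z ≡ [ x ] × a ≤ x × x ≤ b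
chop-inv {a} {b} [ y ] e with a ℤ.≤? y | y ℤ.≤? b
chop-inv [ y ] refl | yes a≤y | yes y≤b = refl , a≤y , y≤b
chop-inv ⊤⁺ ()

-- Finite minima and the entries of a distance product

foldr-⊓-≤ : ∀ {n} (f : Fin n → ℤ∞) {v x} → f v ≡ [ x ] →
            ∃[ s ] foldr _⊓_ ⊤⁺ f ≡ [ s ] × s ≤ x
foldr-⊓-≤ f {v} {x} e = finite (subst (foldr _⊓_ ⊤⁺ f ≤⁺_) e (lower f v))
  where
  lower : ∀ {n} (f : Fin n → ℤ∞) v → foldr _⊓_ ⊤⁺ f ≤⁺ f v
  lower f zero    = x⊓y≤x (f zero) (foldr _⊓_ ⊤⁺ (f ∘ suc))
  lower f (suc v) = ≤⁺-trans ℤ.≤-trans (x⊓y≤y (f zero) (foldr _⊓_ ⊤⁺ (f ∘ suc))) (lower (f ∘ suc) v)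
  finite : ∀ {z} → z ≤⁺ [ x ] → ∃[ s ] z ≡ [ s ] × s ≤ x
  finite [ s≤x ] = _ , refl , s≤x

foldr-⊓-inv : ∀ {n} (f : Fin n → ℤ∞) {s} → foldr _⊓_ ⊤⁺ f ≡ [ s ] → ∃[ v ] f v ≡ [ s ]
foldr-⊓-inv {suc n} f e with ⊓-sel (f zero) (foldr _⊓_ ⊤⁺ (f ∘ suc))
... | inj₁ p = zero , trans (sym p) e
... | inj₂ p with foldr-⊓-inv (f ∘ suc) (trans (sym p) e)
...   | v , q = suc v , q

+∞-inv : ∀ x y {s} → x +∞ y ≡ [ s ] → ∃[ a ] ∃[ b ] x ≡ [ a ] × y ≡ [ b ] × s ≡ a + b
+∞-inv [ a ] [ b ] refl = a , b , refl , refl , refl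

module _ {n} (X Y : Matrix n) {i j : Fin n} where

  ⋆-≤ : ∀ {v a b} → X i v ≡ [ a ] → Y v j ≡ [ b ] → ∃[ s ] (X ⋆ Y) i j ≡ [ s ] × s ≤ a + b
  ⋆-≤ {v} p q = foldr-⊓-≤ (λ k → X i k +∞ Y k j) {v} (cong₂ _+∞_ p q)

  ⋆-inv : ∀ {s} → (X ⋆ Y) i j ≡ [ s ] →
          ∃[ v ] ∃[ a ] ∃[ b ] X i v ≡ [ a ] × Y v j ≡ [ b ] × s ≡ a + b
  ⋆-inv e with foldr-⊓-inv (λ k → X i k +∞ Y k j) e
  ... | v , p = v , +∞-inv (X i v) (Y v j) p

-- Pigeonhole for lists without repetition

Unique⇒lookup-injective : ∀ {A : Set} {xs : List A} → Unique xs →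
                          ∀ {p q} → lookup xs p ≡ lookup xs q → p ≡ q
Unique⇒lookup-injective (_   ∷ _)  {zero}  {zero}  _ = refl
Unique⇒lookup-injective (x∉ ∷ _)  {zero}  {suc q} e = ⊥-elim (All.lookup x∉ (∈-lookup q) e)
Unique⇒lookup-injective (x∉ ∷ _)  {suc p} {zero}  e = ⊥-elim (All.lookup x∉ (∈-lookup p) (sym e))
Unique⇒lookup-injective (_   ∷ xs) {suc p} {suc q} e = cong suc (Unique⇒lookup-injective xs e)

Unique⇒length≤ : ∀ {n} {xs : List (Fin n)} → Unique xs → length xs ℕ.≤ n
Unique⇒length≤ {xs = xs} u =
  Fin.injective⇒≤ (λ {p} {q} → Unique⇒lookup-injective {xs = xs} u {p} {q})

-- Walks and distances

module Walks {n} (G : Graph n) (M : ℤ) (1≤M : 1ℤ ≤ M)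
         (bounds : ∀ {i j} → Graph.Edge G i j → 1ℤ ≤ Graph.cost G i j × Graph.cost G i j ≤ M)
         where

  open Graph G

  open import Data.List.Membership.DecPropositional (Fin._≟_ {n}) using (_∈?_)

  0≤M : 0ℤ ≤ M
  0≤M = ℤ.≤-trans (+≤+ z≤n) 1≤M

  hops : ∀ {i j} → Walk i j → ℕ
  hops ε       = 0
  hops (_ ◅ w) = suc (hops w)

  length-vertices : ∀ {i j} (w : Walk i j) → length (vertices w) ≡ suc (hops w)
  length-vertices ε       = refl
  length-vertices (_ ◅ w) = cong suc (length-vertices w)

  hops≤walkCost : ∀ {i j} (w : Walk i j) → + hops w ≤ walkCost w
  hops≤walkCost ε       = ℤ.≤-refl
  hops≤walkCost (e ◅ w) = proj₁ (bounds e) ⊕ hops≤walkCost w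

  0≤walkCost : ∀ {i j} (w : Walk i j) → 0ℤ ≤ walkCost w
  0≤walkCost w = ℤ.≤-trans (+≤+ z≤n) (hops≤walkCost w)

  walkCost≤hops*M : ∀ {i j} (w : Walk i j) → walkCost w ≤ + hops w * M
  walkCost≤hops*M ε = ℤ.≤-refl
  walkCost≤hops*M (_◅_ {i} {j} e w) =
    lin (proj₂ (bounds e) ⊕ walkCost≤hops*M w) (slack (cost i j) (walkCost w) (+ hops w))
    where
    slack : ∀ a b h → (1ℤ + h) * M - (a + b) ≡ M + h * M - (a + b)
    slack a b h = solve (a ∷ b ∷ h ∷ M ∷ [])

  walkCost-◅◅ : ∀ {i j k} (v : Walk i j) (w : Walk j k) → walkCost (v ◅◅ w) ≡ walkCost v + walkCost w
  walkCost-◅◅ ε w = sym (ℤ.+-identityˡ _)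
  walkCost-◅◅ (_◅_ {i} {j} e v) w =
    trans (cong (_+_ (cost i j)) (walkCost-◅◅ v w)) (sym (ℤ.+-assoc (cost i j) _ _))

  reverse : ∀ {i j} (w : Walk i j) → Σ[ w′ ∈ Walk j i ] walkCost w′ ≡ walkCost w
  reverse ε = ε , refl
  reverse (_◅_ {i} {j} e w) with reverse w
  ... | w′ , p = w′ ◅◅ (symmetric e ◅ ε) ,
    trans (walkCost-◅◅ w′ _)
      (trans (cong₂ _+_ p (trans (ℤ.+-identityʳ _) (sym (cost-sym e)))) (ℤ.+-comm (walkCost w) (cost i j)))

  -- `v` is the last vertex reached at cost at most `s`. The next edge overshoots `s` and costs at
  -- most `M`, so the prefix falls short of `s` by less than `M`; at the end of the walk nothing of
  -- `s` is left and `1 ≤ M` suffices.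
  between : ∀ {i j} (w : Walk i j) {s} → 0ℤ ≤ s → s ≤ walkCost w →
            ∃[ v ] Σ[ w₁ ∈ Walk i v ] Σ[ w₂ ∈ Walk v j ]
            walkCost w₁ + walkCost w₂ ≡ walkCost w × 1ℤ + s ≤ walkCost w₁ + M × walkCost w₁ ≤ s
  between ε {s} 0≤s s≤0 = _ , ε , ε , refl , lin (1≤M ⊕ s≤0) (solve (s ∷ M ∷ [])) , 0≤s
  between (_◅_ {i} {j} e w) {s} 0≤s s≤c with ≤-cases (cost i j) s
  ... | inj₂ s<e = i , ε , e ◅ w , ℤ.+-identityˡ _ ,
    lin (s<e ⊕ proj₂ (bounds e)) (slack s (cost i j)) , 0≤s
    where
    slack : ∀ s c → 0ℤ + M - (1ℤ + s) ≡ c + M - (1ℤ + s + c)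
    slack s c = solve (s ∷ c ∷ M ∷ [])
  ... | inj₁ e≤s with between w (ℤ.i≤j⇒0≤j-i e≤s) (lin s≤c (slack s (cost i j) (walkCost w)))
    where
    slack : ∀ s c d → d - (s - c) ≡ c + d - s
    slack s c d = solve (s ∷ c ∷ d ∷ [])
  ...   | v , w₁ , w₂ , p , q , r = v , e ◅ w₁ , w₂ ,
    trans (ℤ.+-assoc (cost i j) _ _) (cong (_+_ (cost i j)) p) ,
    lin q (slack₁ s (cost i j) (walkCost w₁)) , lin r (slack₂ s (cost i j) (walkCost w₁))
    where
    slack₁ : ∀ s c d → c + d + M - (1ℤ + s) ≡ d + M - (1ℤ + (s - c))
    slack₁ s c d = solve (s ∷ c ∷ d ∷ M ∷ [])
    slack₂ : ∀ s c d → s - (c + d) ≡ s - c - d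
    slack₂ s c d = solve (s ∷ c ∷ d ∷ [])

  split : ∀ a {b i j} (w : Walk i j) → hops w ℕ.≤ a ℕ.+ b →
          ∃[ v ] Σ[ w₁ ∈ Walk i v ] Σ[ w₂ ∈ Walk v j ]
          walkCost w₁ + walkCost w₂ ≡ walkCost w × hops w₁ ℕ.≤ a × hops w₂ ℕ.≤ b
  split zero    w       h       = _ , ε , w , ℤ.+-identityˡ _ , z≤n , h
  split (suc a) ε       h       = _ , ε , ε , refl , z≤n , z≤n
  split (suc a) (_◅_ {i} {j} e w) (s≤s h) with split a w h
  ... | v , w₁ , w₂ , p , q , r = v , e ◅ w₁ , w₂ ,
    trans (ℤ.+-assoc (cost i j) _ _) (cong (_+_ (cost i j)) p) , s≤s q , r

  suffix : ∀ {k i j} (w : Walk i j) → Unique (vertices w) → k ∈ vertices w →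
           Σ[ p ∈ Path k j ] pathCost p ≤ walkCost w
  suffix ε       u       (here refl) = (ε , u) , ℤ.≤-refl
  suffix (e ◅ w) u       (here refl) = (e ◅ w , u) , ℤ.≤-refl
  suffix (_◅_ {i} {j} e w) (_ ∷ u) (there k∈w) with suffix w u k∈w
  ... | p , p≤w = p , lin (p≤w ⊕ ℤ.≤-trans (+≤+ z≤n) (proj₁ (bounds e)))
                          (slack (cost i j) (walkCost w) (pathCost p))
    where
    slack : ∀ c d e → c + d - e ≡ d + c - (e + 0ℤ)
    slack c d e = solve (c ∷ d ∷ e ∷ [])

  -- Loop erasure: the tail is made a path first. If `i` already lies on that path, its part from
  -- `i` on is a path from `i`, and dropping the loop cannot raise the cost because edges have
  -- positive cost.
  shortcut : ∀ {i j} (w : Walk i j) → Σ[ p ∈ Path i j ] pathCost p ≤ walkCost w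
  shortcut ε = (ε , All.[] ∷ []) , ℤ.≤-refl
  shortcut (_◅_ {i} {j} e w) with shortcut w
  ... | (w′ , u) , w′≤w with i ∈? vertices w′
  ...   | no  i∉w′ = (e ◅ w′ , ¬Any⇒All¬ _ i∉w′ ∷ u) , ℤ.+-monoʳ-≤ (cost i j) w′≤w
  ...   | yes i∈w′ with suffix w′ u i∈w′
  ...     | p , p≤w′ = p , lin (p≤w′ ⊕ w′≤w ⊕ ℤ.≤-trans (+≤+ z≤n) (proj₁ (bounds e)))
                             (slack (cost i j) (walkCost w) (walkCost w′) (pathCost p))
    where
    slack : ∀ c d e f → c + d - f ≡ e + d + c - (f + e + 0ℤ)
    slack c d e f = solve (c ∷ d ∷ e ∷ f ∷ [])

  pathHops<n : ∀ {i j} (p : Path i j) → hops (proj₁ p) ℕ.< n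
  pathHops<n (w , u) = subst (ℕ._≤ n) (length-vertices w) (Unique⇒length≤ u)

  -- Matrix entries as costs of walks

  Sound : Matrix n → Set
  Sound X = ∀ {i j c} → X i j ≡ [ c ] → Σ[ w ∈ Walk i j ] walkCost w ≡ c

  -- The counterpart of `Sound`, restricted to short and cheap walks: `h` adds up under products,
  -- and `b` accounts for the entries that `clip` discards. The two predicates together pin an entry
  -- to a minimum.
  Complete : ℕ → ℤ → Matrix n → Set
  Complete h b X = ∀ {i j} (w : Walk i j) → hops w ℕ.≤ h → walkCost w ≤ b →
                   ∃[ c ] X i j ≡ [ c ] × c ≤ walkCost w

  costMatrix-diagonal : ∀ i → costMatrix i i ≡ [ 0ℤ ]
  costMatrix-diagonal i rewrite dec-true (i Fin.≟ i) refl = refl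

  costMatrix-edge : ∀ {i j} → Edge i j → costMatrix i j ≡ [ cost i j ]
  costMatrix-edge {i} {j} e
    rewrite dec-false (i Fin.≟ j) (λ { refl → loopless e }) | dec-true (edge? i j) e = refl

  costMatrix-sound : Sound costMatrix
  costMatrix-sound {i} {j} eq with i Fin.≟ j
  ... | yes refl = ε , []-injective eq
  ... | no  _ with edge? i j
  ...   | yes e = e ◅ ε , trans (ℤ.+-identityʳ _) ([]-injective eq)

  costMatrix-complete : ∀ {b} → Complete 1 b costMatrix
  costMatrix-complete {i = i} ε _ _ = 0ℤ , costMatrix-diagonal i , ℤ.≤-refl
  costMatrix-complete (_◅_ {i} {j} e ε) _ _ = _ , costMatrix-edge e , ℤ.≤-reflexive (sym (ℤ.+-identityʳ _))
  costMatrix-complete (_ ◅ _ ◅ _) (s≤s ()) _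

  ⋆-sound : ∀ {X Y} → Sound X → Sound Y → Sound (X ⋆ Y)
  ⋆-sound {X} {Y} sX sY e with ⋆-inv X Y e
  ... | v , a , b , p , q , refl with sX p | sY q
  ...   | w , refl | w′ , refl = w ◅◅ w′ , walkCost-◅◅ w w′

  ⋆-complete : ∀ {h k b} X Y → Complete h b X → Complete k b Y → Complete (h ℕ.+ k) b (X ⋆ Y)
  ⋆-complete {h} {k} {b} X Y cX cY w w≤h w≤b with split h w w≤h
  ... | v , w₁ , w₂ , p , q , r
    with cX w₁ q (lin (0≤walkCost w₂ ⊕ w₁+w₂≤b) (slack₁ (walkCost w₁) (walkCost w₂)))
       | cY w₂ r (lin (0≤walkCost w₁ ⊕ w₁+w₂≤b) (slack₂ (walkCost w₁) (walkCost w₂)))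
    where
    w₁+w₂≤b : walkCost w₁ + walkCost w₂ ≤ b
    w₁+w₂≤b = subst (_≤ b) (sym p) w≤b
    slack₁ : ∀ x y → b - x ≡ y + b - (0ℤ + (x + y))
    slack₁ x y = solve (x ∷ y ∷ b ∷ [])
    slack₂ : ∀ x y → b - y ≡ x + b - (0ℤ + (x + y))
    slack₂ x y = solve (x ∷ y ∷ b ∷ [])
  ... | c , e , c≤ | d , f , d≤ with ⋆-≤ X Y e f
  ...   | s , g , s≤ = s , g , ℤ.≤-trans s≤ (subst (c + d ≤_) p (c≤ ⊕ d≤))

  -- The minimum over walks with at most k + 1 edges.
  dist : ℕ → Matrix n
  dist zero    = costMatrix
  dist (suc k) = costMatrix ⋆ dist k

  dist-sound : ∀ k → Sound (dist k)
  dist-sound zero    = costMatrix-sound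
  dist-sound (suc k) = ⋆-sound costMatrix-sound (dist-sound k)

  dist-complete : ∀ {b} k → Complete (suc k) b (dist k)
  dist-complete zero    = costMatrix-complete
  dist-complete (suc k) = ⋆-complete costMatrix (dist k) costMatrix-complete (dist-complete k)

  -- The distance matrix and its metric properties

  δ : Matrix n
  δ = dist n

  δ-walk : Sound δ
  δ-walk = dist-sound n

  -- A walk shortens to a path, and a path has fewer than `n` edges, within the range of `dist n`.
  -- The cost bound in `Complete` is instantiated with the cost of that path.
  δ≤walkCost : ∀ {i j} (w : Walk i j) → ∃[ d ] δ i j ≡ [ d ] × d ≤ walkCost w
  δ≤walkCost w with shortcut w
  ... | p , p≤w with dist-complete n (proj₁ p) (ℕ.m≤n⇒m≤1+n (ℕ.<⇒≤ (pathHops<n p))) ℤ.≤-refl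
  ...   | d , e , d≤p = d , e , ℤ.≤-trans d≤p p≤w

  δ-minimal : ∀ {i j d} → δ i j ≡ [ d ] → (w : Walk i j) → d ≤ walkCost w
  δ-minimal e w with δ≤walkCost w
  ... | d′ , e′ , d′≤w = subst (_≤ walkCost w) ([]-unique e′ e) d′≤w

  δ-isDistance : ∀ i j → IsDistance i j (δ i j)
  δ-isDistance i j with δ i j in e
  ... | ⊤⁺ = λ { (w , _) → let _ , e′ , _ = δ≤walkCost w in ≡[]⇒≢⊤ e′ e }
  ... | [ d ] with δ-walk e
  ...   | w , refl with shortcut w
  ...     | p , p≤w = (p , ℤ.≤-antisym p≤w (δ-minimal e (proj₁ p))) , λ p → δ-minimal e (proj₁ p)

  -- A path has at most `n - 1` edges, each of cost at most `M`. The spare `M` on the left later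
  -- keeps every distance away from the window around the top scale.
  δ-bound : ∀ {i j d} → δ i j ≡ [ d ] → d + M ≤ + n * M
  δ-bound e with δ-walk e
  ... | w , refl with shortcut w
  ...   | p , _ = lin (δ-minimal e (proj₁ p) ⊕ walkCost≤hops*M (proj₁ p) ⊕
                       ℤ.*-monoʳ-≤-nonNeg M {{ℤ.nonNegative 0≤M}} (+≤+ (pathHops<n p)))
                      (slack (walkCost w) (pathCost p) (+ hops (proj₁ p)) (+ n))
    where
    slack : ∀ d c h k → k * M - (d + M) ≡ c + h * M + k * M - (d + c + (1ℤ + h) * M)
    slack d c h k = solve (d ∷ c ∷ h ∷ k ∷ M ∷ [])

  δ-nonNegative : ∀ {i j d} → δ i j ≡ [ d ] → 0ℤ ≤ d
  δ-nonNegative e with δ-walk e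
  ... | w , refl = 0≤walkCost w

  δ-diagonal : ∀ i → δ i i ≡ [ 0ℤ ]
  δ-diagonal i with δ≤walkCost (ε {x = i})
  ... | d , e , d≤0 = trans e (cong [_] (ℤ.≤-antisym d≤0 (δ-nonNegative e)))

  δ-triangle : ∀ {i j k a b} → δ i j ≡ [ a ] → δ j k ≡ [ b ] → ∃[ c ] δ i k ≡ [ c ] × c ≤ a + b
  δ-triangle p q with δ-walk p | δ-walk q
  ... | w , refl | w′ , refl with δ≤walkCost (w ◅◅ w′)
  ...   | c , e , c≤ = c , e , subst (c ≤_) (walkCost-◅◅ w w′) c≤

  -- Reversal preserves cost, so minimality can be applied in both directions.
  δ-sym : ∀ {i j d} → δ i j ≡ [ d ] → δ j i ≡ [ d ]
  δ-sym e with δ-walk e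
  ... | w , refl with reverse w
  ...   | w′ , w′≡w with δ≤walkCost w′
  ...     | d , e′ , d≤ with δ-walk e′
  ...       | u , refl with reverse u
  ...         | u′ , u′≡u = trans e′ (cong [_] (ℤ.≤-antisym (subst (walkCost u ≤_) w′≡w d≤)
                                                           (subst (walkCost w ≤_) u′≡u (δ-minimal e u′))))

  -- Both parts of a shortest walk are themselves shortest: by the triangle inequality a saving on
  -- either part would be a saving on the whole.
  δ-between : ∀ {i j d s} → δ i j ≡ [ d ] → 0ℤ ≤ s → s ≤ d →
              ∃[ v ] ∃[ a ] δ i v ≡ [ a ] × δ v j ≡ [ d - a ] × 1ℤ + s ≤ a + M × a ≤ s
  δ-between {i} {j} {s = s} e 0≤s s≤d with δ-walk e
  ... | w , refl with between w 0≤s s≤d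
  ...   | v , w₁ , w₂ , p , q , r with δ≤walkCost w₁ | δ≤walkCost w₂
  ...     | a , e₁ , a≤ | b , e₂ , b≤ with δ-triangle e₁ e₂
  ...       | c , e₃ , c≤ with []-unique e e₃
  ...         | refl = v , a , e₁ , trans e₂ (cong [_] b≡) ,
    subst (λ x → 1ℤ + s ≤ x + M) (sym a≡) q , subst (_≤ s) (sym a≡) r
    where
    x = walkCost w₁
    y = walkCost w₂
    a≡ : a ≡ x
    a≡ = ℤ.≤-antisym a≤ (lin (ℤ.≤-trans (ℤ.≤-reflexive p) c≤ ⊕ b≤) (slack x y))
      where
      slack : ∀ x y → a - x ≡ a + b + y - (x + y + b)
      slack x y = solve (x ∷ y ∷ a ∷ b ∷ [])
    b≡ : b ≡ walkCost w - a
    b≡ = ℤ.≤-antisym (lin (b≤ ⊕ ℤ.≤-reflexive p ⊕ a≤) (slack₁ (walkCost w) y x))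
                     (lin c≤ (slack₂ (walkCost w)))
      where
      slack₁ : ∀ d y x → d - a - b ≡ y + d + x - (b + (x + y) + a)
      slack₁ d y x = solve (d ∷ y ∷ x ∷ a ∷ b ∷ [])
      slack₂ : ∀ d → b - (d - a) ≡ a + b - d
      slack₂ d = solve (d ∷ a ∷ b ∷ [])

  -- Truncated squaring, which computes `D`

  squaring : ℤ → ℕ → Matrix n
  squaring b = fold costMatrix λ X → clip (X ⋆ X) 0ℤ b

  clip-sound : ∀ {X b} → Sound X → Sound (clip X 0ℤ b)
  clip-sound {X} sX {i} {j} e with clip-inv (X i j) e
  ... | y , p , inj₁ (y≤0 , refl) with sX p
  ...   | w , refl = w , ℤ.≤-antisym y≤0 (0≤walkCost w)
  clip-sound {X} sX {i} {j} e | y , p , inj₂ (_ , _ , refl) = sX p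

  -- Soundness makes the entry nonnegative, so the lower end of the clip leaves it unchanged.
  clip-complete : ∀ {h b} X → Sound X → Complete h b X → Complete h b (clip X 0ℤ b)
  clip-complete X sX cX w h w≤b with cX w h w≤b
  ... | c , e , c≤w with sX e
  ...   | w′ , refl = c , trans (cong (clip∞ 0ℤ _) e) (clip-mid (0≤walkCost w′) (ℤ.≤-trans c≤w w≤b)) , c≤w

  squaring-sound : ∀ b s → Sound (squaring b s)
  squaring-sound b zero    = costMatrix-sound
  squaring-sound b (suc s) = clip-sound (⋆-sound (squaring-sound b s) (squaring-sound b s))

  squaring-complete : ∀ b s → Complete (2 ^ s) b (squaring b s)
  squaring-complete b zero    = costMatrix-complete
  squaring-complete b (suc s) w h =
    clip-complete (X ⋆ X) (⋆-sound (squaring-sound b s) (squaring-sound b s))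
      (⋆-complete X X (squaring-complete b s) (squaring-complete b s))
      w (subst (hops w ℕ.≤_) (cong (2 ^ s ℕ.+_) (ℕ.+-identityʳ _)) h)
    where X = squaring b s

  squaring-≤ : ∀ {b} s {i j c} → 0ℤ ≤ b → squaring b (suc s) i j ≡ [ c ] → c ≤ b
  squaring-≤ s 0≤b e with clip-inv ((squaring _ s ⋆ squaring _ s) _ _) e
  ... | _ , _ , inj₁ (_ , refl)         = 0≤b
  ... | _ , _ , inj₂ (_ , y≤b , refl) = y≤b

  -- Edges cost at least 1, so a walk of cost at most 2 ^ s has at most 2 ^ s edges.
  squaring-δ : ∀ {b} s {i j d} → b ≡ + (2 ^ s) → δ i j ≡ [ d ] → d ≤ b → squaring b s i j ≡ [ d ]
  squaring-δ s refl e d≤b with δ-walk e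
  ... | w , refl with squaring-complete _ s w (ℤ.drop‿+≤+ (ℤ.≤-trans (hops≤walkCost w) d≤b)) d≤b
  ...   | c , f , c≤ with squaring-sound _ s f
  ...     | w′ , refl = trans f (cong [_] (ℤ.≤-antisym c≤ (δ-minimal e w′)))

  -- A finite entry is the cost of a walk, so δ is finite and at most `b`, and `squaring-δ`
  -- identifies the two. The bound `c ≤ b` comes from the last clip, hence at least one round.
  squaring-inv : ∀ {b} s {i j c} → b ≡ + (2 ^ suc s) → squaring b (suc s) i j ≡ [ c ] →
                 δ i j ≡ [ c ] × c ≤ b
  squaring-inv {b} s {c = c} b≡ f with squaring-sound _ (suc s) f
  ... | w , refl with δ≤walkCost w
  ...   | d , e , d≤ = trans e (cong [_] ([]-unique (squaring-δ (suc s) b≡ e (ℤ.≤-trans d≤ c≤b)) f)) , c≤b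
    where
    c≤b : c ≤ b
    c≤b = squaring-≤ s (subst (0ℤ ≤_) (sym b≡) (+≤+ z≤n)) f

-- Quotients, remainders and parity

finite? : ∀ (x : ℤ∞) → x ≡ ⊤⁺ ⊎ ∃[ c ] x ≡ [ c ]
finite? [ c ] = inj₂ (c , refl)
finite? ⊤⁺    = inj₁ refl

≢[]⇒≡⊤ : ∀ {x : ℤ∞} → (∀ {c} → x ≢ [ c ]) → x ≡ ⊤⁺
≢[]⇒≡⊤ {[ c ]} x≢[] = ⊥-elim (x≢[] refl)
≢[]⇒≡⊤ {⊤⁺}    _    = refl

even-or-odd : ∀ q → ∃[ h ] (q ≡ h ℕ.+ h ⊎ q ≡ suc (h ℕ.+ h))
even-or-odd zero = 0 , inj₁ refl
even-or-odd (suc q) with even-or-odd q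
... | h , inj₁ refl = h , inj₂ refl
... | h , inj₂ refl = suc h , inj₁ (cong suc (sym (ℕ.+-suc h h)))

divide : ∀ {d L} → 0ℤ ≤ d → 1ℤ ≤ L → ∃[ q ] ∃[ r ] d ≡ + q * L + r × 0ℤ ≤ r × 1ℤ + r ≤ L
divide {+ d} {+ suc L} _ _ =
  d / suc L , + (d % suc L) ,
  trans (cong +_ (trans (m≡m%n+[m/n]*n d (suc L)) (ℕ.+-comm (d % suc L) _)))
        (cong (_+ + (d % suc L)) (ℤ.pos-* (d / suc L) (suc L))) ,
  +≤+ z≤n , +≤+ (m%n<n d (suc L))
divide {+ _} {+ zero} _ (+≤+ ())

suc-* : ∀ q L → (1ℤ + q) * L ≡ q * L + L
suc-* q L = solve (q ∷ L ∷ [])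

multiples-≤ : ∀ {L} q p → 0ℤ ≤ L → + q * L ≤ + p * L ⊎ + p * L + L ≤ + q * L
multiples-≤ {L} q p 0≤L with q ℕ.≤? p
... | yes q≤p = inj₁ (ℤ.*-monoʳ-≤-nonNeg L {{ℤ.nonNegative 0≤L}} (+≤+ q≤p))
... | no  q≰p = inj₂ (subst (_≤ + q * L) (suc-* (+ p) L)
                            (ℤ.*-monoʳ-≤-nonNeg L {{ℤ.nonNegative 0≤L}} (+≤+ (ℕ.≰⇒> q≰p))))

0≤multiple : ∀ {L} q → 0ℤ ≤ L → 0ℤ ≤ + q * L
0≤multiple {L} q 0≤L = ℤ.*-monoʳ-≤-nonNeg L {{ℤ.nonNegative 0≤L}} (+≤+ (z≤n {q}))

-- Clipping to the interval from `- M` to `M`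

module _ {M : ℤ} (1≤M : 1ℤ ≤ M) where

  -M≤M : - M ≤ M
  -- `+≤+ (z≤n {2})` is `0 ≤ 2`, a constant that pads the slack of the summed hypotheses to that of
  -- the goal.
  -M≤M = lin (1≤M ⊕ 1≤M ⊕ +≤+ (z≤n {2})) (solve (M ∷ []))

  -- Equality of `S` and `[ t ]` is too much to ask, as clipping hides it at both ends. Above `M`
  -- the lower bound alone sends both to `⊤⁺`; otherwise a witness at most `- M` forces `t` below
  -- `- M` as well, and both clip to `- M`.
  clip-cong : ∀ {S t} → (∀ {s} → S ≡ [ s ] → t ≤ s) →
              (t ≤ M → ∃[ s ] S ≡ [ s ] × (s ≤ t ⊎ s ≤ - M)) →
              clip∞ (- M) M S ≡ clip∞ (- M) M [ t ]
  clip-cong {S} {t} lower upper with ≤-cases t M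
  clip-cong {[ s ]} {t} lower upper | inj₂ M<t =
    trans (clip-> -M≤M (ℤ.≤-trans M<t (lower refl))) (sym (clip-> -M≤M M<t))
  clip-cong {⊤⁺} lower upper | inj₂ M<t = sym (clip-> -M≤M M<t)
  clip-cong lower upper | inj₁ t≤M with upper t≤M
  ... | s , refl , inj₁ s≤t  = cong (λ x → clip∞ _ _ [ x ]) (ℤ.≤-antisym s≤t (lower refl))
  ... | s , refl , inj₂ s≤-M = trans (clip-≤ -M≤M s≤-M) (sym (clip-≤ -M≤M (ℤ.≤-trans (lower refl) s≤-M)))

  clip-negative : ∀ {t} → 1ℤ + t ≤ 0ℤ → ∃[ c ] clip∞ (- M) M [ t ] ≡ [ c ] × 1ℤ + c ≤ 0ℤ
  clip-negative {t} t<0 with ≤-cases t (- M)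
  ... | inj₁ t≤-M = - M , clip-≤ -M≤M t≤-M , lin 1≤M (solve (M ∷ []))
  ... | inj₂ -M<t = t , clip-mid (lin (-M<t ⊕ +≤+ (z≤n {1})) (solve (t ∷ M ∷ [])))
                                 (lin (t<0 ⊕ 1≤M ⊕ +≤+ (z≤n {2})) (solve (t ∷ M ∷ []))) , t<0

  -- Phrased through the two tests of the algorithm because the clipped value may be `⊤⁺`, which
  -- counts as nonnegative.
  clip-nonNegative : ∀ {t} → 0ℤ ≤ t →
                     does ([ 0ℤ ] ≤? clip∞ (- M) M [ t ]) ≡ true ×
                     does (clip∞ (- M) M [ t ] <? [ 0ℤ ]) ≡ false
  clip-nonNegative {t} 0≤t with ≤-cases t M
  ... | inj₂ M<t rewrite clip-> {a = - M} -M≤M M<t = refl , refl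
  ... | inj₁ t≤M
    rewrite clip-mid {a = - M} {x = t} (lin (0≤t ⊕ 1≤M ⊕ +≤+ (z≤n {1})) (solve (t ∷ M ∷ []))) t≤M =
    dec-true (0ℤ ℤ.≤? t) 0≤t , dec-false (t ℤ.<? 0ℤ) (ℤ.≤⇒≯ 0≤t)

-- Distance products

module Iteration {n} (G : Graph n) (M : ℤ) (1≤M : 1ℤ ≤ M)
         (bounds : ∀ {i j} → Graph.Edge G i j → 1ℤ ≤ Graph.cost G i j × Graph.cost G i j ≤ M)
         where

  open Graph G

  open Walks G M 1≤M bounds public

  clipᴹ : ℤ∞ → ℤ∞
  clipᴹ = clip∞ (- M) M

  -- Shifted distances, the form of `A k`

  record Shifted (K : ℤ) (X : Matrix n) : Set where
    field
      finite   : ∀ {i j d} → δ i j ≡ [ d ] → X i j ≡ clipᴹ [ d - K ]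
      infinite : ∀ {i j} → δ i j ≡ ⊤⁺ → X i j ≡ ⊤⁺

    -- Clipping from below only raises an entry, so `d - K` remains a lower bound; finiteness
    -- excludes clipping from above.
    inverse : ∀ {i j a} → X i j ≡ [ a ] → ∃[ d ] δ i j ≡ [ d ] × d - K ≤ a × d - K ≤ M
    inverse {i} {j} e with finite? (δ i j)
    ... | inj₁ p = contradiction (infinite p) (≡[]⇒≢⊤ e)
    ... | inj₂ (d , p) with clip-inv [ d - K ] (trans (sym (finite p)) e)
    ...   | _ , refl , inj₁ (y≤-M , refl)    = d , p , y≤-M , ℤ.≤-trans y≤-M (-M≤M 1≤M)
    ...   | _ , refl , inj₂ (_ , y≤M , refl) = d , p , ℤ.≤-refl , y≤M

  -- What an upper bound on a product requires of its left factor. The window holds exactly `2M`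
  -- offsets, so an integer has at most one such offset from the multiples of `2M`.
  ExactNear : ℤ → Matrix n → Set
  ExactNear b X = ∀ {i v x} → δ i v ≡ [ b + x ] → 1ℤ - M ≤ x → x ≤ M → X i v ≡ [ x ]

  -M≤x : ∀ {x} → 1ℤ - M ≤ x → - M ≤ x
  -M≤x {x} 1-M≤x = lin (1-M≤x ⊕ +≤+ (z≤n {1})) (solve (x ∷ M ∷ []))

  Shifted⇒ExactNear : ∀ {K X} → Shifted K X → ExactNear K X
  Shifted⇒ExactNear {K} sX {x = x} e 1-M≤x x≤M =
    trans (Shifted.finite sX e)
      (trans (cong (λ y → clipᴹ [ y ]) (slack K x)) (clip-mid (-M≤x 1-M≤x) x≤M))
    where
    slack : ∀ K x → K + x - K ≡ x
    slack K x = solve (K ∷ x ∷ [])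

  module _ {b K : ℤ} {X Y : Matrix n} (M≤K : M ≤ K) (eX : ExactNear b X) (sY : Shifted K Y)
           {i j : Fin n} {d : ℤ} where

    -- For `v` on a shortest path, `X i v` is `a - b`. If `Y v j` is unclipped, the sum is
    -- `d - b - K`. If it is clipped to `- M`, the sum is `a - b - M`, and the last hypothesis says
    -- which of the two admissible bounds this meets.
    ⋆-upper-via : ∀ {v a} → δ i v ≡ [ a ] → δ v j ≡ [ d - a ] → 1ℤ + b ≤ a + M → a ≤ b + M →
                  d - a - K ≤ M → a ≤ b ⊎ a - M ≤ d - K →
                  ∃[ s ] (X ⋆ Y) i j ≡ [ s ] × (s ≤ d - b - K ⊎ s ≤ - M)
    ⋆-upper-via {v} {a} p q b<a+M a≤b+M t≤M c = combine (≤-cases (d - a - K) (- M)) c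
      where
      Xiv : X i v ≡ [ a - b ]
      Xiv = eX (trans p (cong [_] eq))
        (lin b<a+M (solve (a ∷ b ∷ M ∷ []))) (lin a≤b+M (solve (a ∷ b ∷ M ∷ [])))
        where
        eq : a ≡ b + (a - b)
        eq = solve (a ∷ b ∷ [])
      combine : d - a - K ≤ - M ⊎ 1ℤ + - M ≤ d - a - K → a ≤ b ⊎ a - M ≤ d - K →
                ∃[ s ] (X ⋆ Y) i j ≡ [ s ] × (s ≤ d - b - K ⊎ s ≤ - M)
      combine (inj₁ t≤-M) c with ⋆-≤ X Y Xiv (trans (Shifted.finite sY q) (clip-≤ (-M≤M 1≤M) t≤-M)) | c
      ... | s , e , s≤ | inj₁ a≤b   = s , e , inj₂ (lin (s≤ ⊕ a≤b) (solve (s ∷ a ∷ b ∷ M ∷ [])))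
      ... | s , e , s≤ | inj₂ a≤d+M = s , e , inj₁ (lin (s≤ ⊕ a≤d+M) (solve (s ∷ a ∷ b ∷ d ∷ K ∷ M ∷ [])))
      combine (inj₂ -M<t) _
        with ⋆-≤ X Y Xiv (trans (Shifted.finite sY q) (clip-mid (ℤ.≤-trans (ℤ.i≤suc[i] (- M)) -M<t) t≤M))
      ... | s , e , s≤ = s , e , inj₁ (lin s≤ (solve (s ∷ a ∷ b ∷ d ∷ K ∷ [])))

    ⋆-upper : δ i j ≡ [ d ] → 0ℤ ≤ b → b ≤ d → d - b - K ≤ M →
              ∃[ s ] (X ⋆ Y) i j ≡ [ s ] × (s ≤ d - b - K ⊎ s ≤ - M)
    ⋆-upper e 0≤b b≤d t≤M with ≤-cases (b + K) d
    -- A far target takes `a` just beyond `b`, with `b < a ≤ b + M`: a vertex before `b` could leave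
    -- `d - a - K` above `M`.
    ... | inj₁ b+K≤d with δ-between e (0≤b ⊕ 0≤M) (lin (b+K≤d ⊕ M≤K) (solve (b ∷ d ∷ K ∷ M ∷ [])))
    ...   | v , a , p , q , b+M<a+M , a≤b+M =
      ⋆-upper-via p q (lin (b+M<a+M ⊕ 0≤M) (solve (a ∷ b ∷ M ∷ []))) a≤b+M
        (lin (t≤M ⊕ b+M<a+M ⊕ +≤+ (z≤n {1})) (solve (a ∷ b ∷ d ∷ K ∷ M ∷ [])))
        (inj₂ (lin (a≤b+M ⊕ b+K≤d) (solve (a ∷ b ∷ d ∷ K ∷ M ∷ []))))
    -- A near target takes `b - M < a ≤ b`; then `d - a - K` is below `M` by the choice of `a`
    -- alone.
    ⋆-upper e 0≤b b≤d t≤M | inj₂ d<b+K with δ-between e 0≤b b≤d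
    ...   | v , a , p , q , b<a+M , a≤b =
      ⋆-upper-via p q b<a+M (lin (a≤b ⊕ 0≤M) (solve (a ∷ b ∷ M ∷ [])))
        (lin (d<b+K ⊕ b<a+M ⊕ +≤+ (z≤n {2})) (solve (a ∷ b ∷ d ∷ K ∷ M ∷ [])))
        (inj₁ a≤b)

  Shifted-⋆ : ∀ {K X} → M ≤ K → Shifted K X → Shifted (K + K) (clip (X ⋆ X) (- M) M)
  Shifted-⋆ {K} {X} M≤K sX = record { finite = finite ; infinite = infinite }
    where
    diagonal : ∀ j → X j j ≡ [ - M ]
    diagonal j = trans (Shifted.finite sX (δ-diagonal j))
      (clip-≤ {x = 0ℤ - K} (-M≤M 1≤M) (lin M≤K (solve (K ∷ M ∷ []))))
    finite : ∀ {i j d} → δ i j ≡ [ d ] → clipᴹ ((X ⋆ X) i j) ≡ clipᴹ [ d - (K + K) ]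
    finite {i} {j} {d} e = clip-cong 1≤M lower upper
      where
      lower : ∀ {s} → (X ⋆ X) i j ≡ [ s ] → d - (K + K) ≤ s
      lower f with ⋆-inv X X f
      ... | v , a , b , p , q , refl with Shifted.inverse sX p | Shifted.inverse sX q
      ...   | a′ , p′ , a′≤ , _ | b′ , q′ , b′≤ , _ with δ-triangle p′ q′
      ...     | c , r , c≤ with []-unique e r
      ...       | refl = lin (c≤ ⊕ a′≤ ⊕ b′≤) (solve (a ∷ b ∷ d ∷ a′ ∷ b′ ∷ K ∷ []))
      t≡ : d - K - K ≡ d - (K + K)
      t≡ = solve (d ∷ K ∷ [])
      upper : d - (K + K) ≤ M → ∃[ s ] (X ⋆ X) i j ≡ [ s ] × (s ≤ d - (K + K) ⊎ s ≤ - M)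
      upper t≤M with ≤-cases K d
      ... | inj₁ K≤d = subst (λ t → ∃[ s ] (X ⋆ X) i j ≡ [ s ] × (s ≤ t ⊎ s ≤ - M)) t≡
        (⋆-upper M≤K (Shifted⇒ExactNear sX) sX e (ℤ.≤-trans 0≤M M≤K) K≤d (subst (_≤ M) (sym t≡) t≤M))
      -- Below `K` the vertex `j` itself serves: its diagonal entry `- M` brings the sum to at most
      -- `- M`.
      ... | inj₂ d<K with ≤-cases (d - K) (- M)
      ...   | inj₁ d-K≤-M with ⋆-≤ X X (trans (Shifted.finite sX e) (clip-≤ (-M≤M 1≤M) d-K≤-M)) (diagonal j)
      ...     | s , f , s≤ = s , f , inj₂ (lin (s≤ ⊕ 0≤M) (solve (s ∷ M ∷ [])))
      upper t≤M | inj₂ d<K | inj₂ -M<d-K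
        with ⋆-≤ X X (trans (Shifted.finite sX e) (clip-mid (ℤ.≤-trans (ℤ.i≤suc[i] (- M)) -M<d-K)
                        (lin (d<K ⊕ 0≤M ⊕ +≤+ (z≤n {1})) (solve (d ∷ K ∷ M ∷ []))))) (diagonal j)
      ...     | s , f , s≤ = s , f , inj₂ (lin (s≤ ⊕ d<K ⊕ +≤+ (z≤n {1})) (solve (s ∷ d ∷ K ∷ M ∷ [])))
    infinite : ∀ {i j} → δ i j ≡ ⊤⁺ → clipᴹ ((X ⋆ X) i j) ≡ ⊤⁺
    infinite {i} {j} e = cong clipᴹ {y = ⊤⁺} (≢[]⇒≡⊤ λ f →
      let v , a , b , p , q , _ = ⋆-inv X X f
          _ , p′ , _ = Shifted.inverse sX p
          _ , q′ , _ = Shifted.inverse sX q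
          _ , r , _ = δ-triangle p′ q′
      in ≡[]⇒≢⊤ r e)

  -- A finite entry is the offset of δ from the progression `c`, `c + L`, and so on. Offsets may be
  -- negative, so `q` may index a term above δ.
  record Periodic (L c : ℤ) (X : Matrix n) : Set where
    field
      sound : ∀ {i j x} → X i j ≡ [ x ] →
              ∃[ q ] δ i j ≡ [ + q * L + c + x ] × 1ℤ - M ≤ x × x ≤ M
      exact : ∀ q {i j x} → δ i j ≡ [ + q * L + c + x ] → 1ℤ - M ≤ x → x ≤ M → X i j ≡ [ x ]

  module _ {L c K X Y} (pX : Periodic L c X) (sY : Shifted K Y) {i j : Fin n} where

    ⋆-infinite : δ i j ≡ ⊤⁺ → (X ⋆ Y) i j ≡ ⊤⁺
    ⋆-infinite e = ≢[]⇒≡⊤ λ f →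
      let v , a , b , p , q , _ = ⋆-inv X Y f
          _ , p′ , _ = Periodic.sound pX p
          _ , q′ , _ = Shifted.inverse sY q
          _ , r , _ = δ-triangle p′ q′
      in ≡[]⇒≢⊤ r e

    -- A vertex v in the window of a later multiple of L is too far from j for Y v j to be
    -- finite: here the symmetry of δ is used.
    clip-⋆ : 0ℤ ≤ c → M + M ≤ K → K + K + (K + K) ≤ L →
             ∀ q {r} → δ i j ≡ [ + q * L + c + r ] → 0ℤ ≤ r → 1ℤ + r ≤ K + K →
             clipᴹ ((X ⋆ Y) i j) ≡ clipᴹ [ r - K ]
    clip-⋆ 0≤c 2M≤K 4K≤L q {r} e 0≤r r<2K = clip-cong 1≤M lower upper
      where
      0≤K : 0ℤ ≤ K
      0≤K = ℤ.≤-trans (0≤M ⊕ 0≤M) 2M≤K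
      0≤L : 0ℤ ≤ L
      0≤L = ℤ.≤-trans (0≤K ⊕ 0≤K ⊕ (0≤K ⊕ 0≤K)) 4K≤L
      M≤K : M ≤ K
      M≤K = lin (2M≤K ⊕ 0≤M) (solve (M ∷ K ∷ []))
      t≡ : ∀ b → b + r - b - K ≡ r - K
      t≡ b = solve (b ∷ r ∷ K ∷ [])
      upper : r - K ≤ M → ∃[ s ] (X ⋆ Y) i j ≡ [ s ] × (s ≤ r - K ⊎ s ≤ - M)
      upper t≤M = subst (λ t → ∃[ s ] (X ⋆ Y) i j ≡ [ s ] × (s ≤ t ⊎ s ≤ - M)) (t≡ (+ q * L + c))
        (⋆-upper M≤K (Periodic.exact pX q) sY e (0≤multiple q 0≤L ⊕ 0≤c)
          (lin 0≤r (slack (+ q * L + c))) (subst (_≤ M) (sym (t≡ (+ q * L + c))) t≤M))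
        where
        slack : ∀ b → b + r - b ≡ r - 0ℤ
        slack b = solve (b ∷ r ∷ [])
      -- The triangle inequality from `i` through `v` to `j`, for a window that is not later than
      -- that of `q`.
      before : ∀ {p p′ x d′ y} → p + c + r ≤ p′ + c + x + d′ → d′ - K ≤ y → p′ ≤ p → r - K ≤ x + y
      before {p} {p′} {x} {d′} {y} tri d′≤ p′≤p =
        lin (tri ⊕ d′≤ ⊕ p′≤p) (solve (p ∷ p′ ∷ x ∷ d′ ∷ y ∷ c ∷ r ∷ K ∷ []))
      -- The triangle inequality from `i` through `j` to `v` gives `L + 1 - M ≤ r + d′ < 3K + M`,
      -- against `4K ≤ L` and `2M ≤ K`.
      after : ∀ {p p′ x d′} → p′ + c + x ≤ p + c + r + d′ → d′ - K ≤ M → p + L ≤ p′ → 1ℤ - M ≤ x → ⊥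
      after {p} {p′} {x} {d′} tri d′≤ p<p′ x> =
        lin-⊥ (tri ⊕ d′≤ ⊕ p<p′ ⊕ x> ⊕ 4K≤L ⊕ r<2K ⊕ 2M≤K ⊕ +≤+ (z≤n {1}))
          (solve (p ∷ p′ ∷ x ∷ d′ ∷ c ∷ r ∷ K ∷ L ∷ M ∷ []))
      lower : ∀ {s} → (X ⋆ Y) i j ≡ [ s ] → r - K ≤ s
      lower f with ⋆-inv X Y f
      ... | v , x , y , g , h , refl with Periodic.sound pX g | Shifted.inverse sY h
      ...   | q′ , g′ , x> , _ | d′ , h′ , d′≤y , d′≤M with multiples-≤ {L} q′ q 0≤L
      ...     | inj₁ q′≤q with δ-triangle g′ h′
      ...       | _ , k , tri with []-unique e k
      ...         | refl = before {+ q * L} {+ q′ * L} tri d′≤y q′≤q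
      lower f | v , x , y , g , h , refl | q′ , g′ , x> , _ | d′ , h′ , d′≤y , d′≤M | inj₂ q<q′
        with δ-triangle e (δ-sym h′)
      ...       | _ , k , tri with []-unique g′ k
      ...         | refl = ⊥-elim (after {+ q * L} {+ q′ * L} tri d′≤M q<q′ x>)

  -- Binary digits and the step to half the scale

  Digit : ℤ → Matrix n → Set
  Digit K C = ∀ q {i j r} → δ i j ≡ [ + q * (K + K) + r ] → 0ℤ ≤ r → 1ℤ + r ≤ K + K →
              C i j ≡ clipᴹ [ r - K ]

  select : Matrix n → Matrix n → Matrix n → Matrix n
  select C X Y = (X ⋀ C) ⋁ (Y ⋀̄ C)

  select-⊤ : ∀ {C X Y i j} → X i j ≡ ⊤⁺ → Y i j ≡ ⊤⁺ → select C X Y i j ≡ ⊤⁺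
  select-⊤ {C} {i = i} {j} p q rewrite p | q with does (C i j <? [ 0ℤ ]) | does ([ 0ℤ ] ≤? C i j)
  ... | true  | true  = refl
  ... | true  | false = refl
  ... | false | true  = refl
  ... | false | false = refl

  select-negative : ∀ {C t} X Y {i j} → C i j ≡ clipᴹ [ t ] → 1ℤ + t ≤ 0ℤ → select C X Y i j ≡ X i j
  select-negative {C} {t} X Y {i} {j} p t<0 with clip-negative 1≤M {t} t<0
  ... | c , q , c<0 rewrite trans p q
        | dec-true (c ℤ.<? 0ℤ) (ℤ.suc[i]≤j⇒i<j c<0) | dec-false (0ℤ ℤ.≤? c) (suc≤⇒≰ c<0) with X i j
  ...   | [ _ ] = refl
  ...   | ⊤⁺    = refl

  select-nonNegative : ∀ {C t} X Y {i j} → C i j ≡ clipᴹ [ t ] → 0ℤ ≤ t → select C X Y i j ≡ Y i j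
  select-nonNegative {C} {t} X Y p 0≤t with clip-nonNegative 1≤M {t} 0≤t
  ... | q , r rewrite p | q | r = refl

  module _ {K A C P Q} (2M≤K : M + M ≤ K) (sA : Shifted K A) (dC : Digit (K + K) C)
           (pP : Periodic (K + K + (K + K)) 0ℤ P) (pQ : Periodic (K + K + (K + K)) (K + K) Q) where

    private
      C′ : Matrix n
      C′ = select C (clip (P ⋆ A) (- M) M) (clip (Q ⋆ A) (- M) M)

    -- The parity of `q` decides whether the remainder modulo `4K` is `r` or `r + 2K`, that is,
    -- whether `C` is negative. An even `q` selects `P`, whose progression contains the base
    -- `q * 2K`; an odd `q` selects `Q`.
    Digit-step : Digit K C′
    Digit-step q {i} {j} {r} e 0≤r r<2K = go (even-or-odd q)
      where
      X Y : Matrix n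
      X = clip (P ⋆ A) (- M) M
      Y = clip (Q ⋆ A) (- M) M
      0≤2K : 0ℤ ≤ K + K
      0≤2K = ℤ.≤-trans (0≤M ⊕ 0≤M ⊕ (0≤M ⊕ 0≤M)) (2M≤K ⊕ 2M≤K)
      even : ∀ h → (h + h) * (K + K) + r ≡ h * (K + K + (K + K)) + r
      even h = solve (h ∷ r ∷ K ∷ [])
      even′ : ∀ h → (h + h) * (K + K) + r ≡ h * (K + K + (K + K)) + 0ℤ + r
      even′ h = solve (h ∷ r ∷ K ∷ [])
      odd : ∀ h → (1ℤ + (h + h)) * (K + K) + r ≡ h * (K + K + (K + K)) + (r + (K + K))
      odd h = solve (h ∷ r ∷ K ∷ [])
      odd′ : ∀ h → (1ℤ + (h + h)) * (K + K) + r ≡ h * (K + K + (K + K)) + (K + K) + r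
      odd′ h = solve (h ∷ r ∷ K ∷ [])
      go : ∃[ h ] (q ≡ h ℕ.+ h ⊎ q ≡ suc (h ℕ.+ h)) → C′ i j ≡ clipᴹ [ r - K ]
      go (h , inj₁ refl) = trans
        (select-negative {C} {t = r - (K + K)} X Y
          (dC h (trans e (cong [_] (even (+ h)))) 0≤r (lin (r<2K ⊕ 0≤2K) (solve (r ∷ K ∷ []))))
          (lin r<2K (solve (r ∷ K ∷ []))))
        (clip-⋆ pP sA ℤ.≤-refl 2M≤K ℤ.≤-refl h (trans e (cong [_] (even′ (+ h)))) 0≤r r<2K)
      go (h , inj₂ refl) = trans
        (select-nonNegative {C} {t = r + (K + K) - (K + K)} X Y
          (dC h (trans e (cong [_] (odd (+ h)))) (0≤r ⊕ 0≤2K) (lin r<2K (solve (r ∷ K ∷ []))))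
          (lin 0≤r (solve (r ∷ K ∷ []))))
        (clip-⋆ pQ sA 0≤2K 2M≤K ℤ.≤-refl h (trans e (cong [_] (odd′ (+ h)))) 0≤r r<2K)

    -- `Digit` is silent where δ is infinite, as the initial `C` is `- M` everywhere. After one step
    -- such entries are infinite.
    infinite-step : ∀ {i j} → δ i j ≡ ⊤⁺ → C′ i j ≡ ⊤⁺
    infinite-step {i} {j} e = select-⊤ {C} {clip (P ⋆ A) (- M) M} {clip (Q ⋆ A) (- M) M}
      (cong clipᴹ {y = ⊤⁺} (⋆-infinite pP sA e)) (cong clipᴹ {y = ⊤⁺} (⋆-infinite pQ sA e))

  -- An offset `x` from an odd multiple of `K` means remainder `K + x` modulo `2K`, within range
  -- because `2M ≤ K`; the entry of `C` is then `x` itself.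
  Periodic-chop : ∀ {K C} → M + M ≤ K → Digit K C → (∀ {i j} → δ i j ≡ ⊤⁺ → C i j ≡ ⊤⁺) →
                  Periodic (K + K) K (chop C (1ℤ - M) M)
  Periodic-chop {K} {C} 2M≤K dC C-⊤ = record { sound = sound ; exact = exact }
    where
    1≤2K : 1ℤ ≤ K + K
    1≤2K = lin (1≤M ⊕ 2M≤K ⊕ 2M≤K ⊕ 0≤M ⊕ 0≤M ⊕ 0≤M) (solve (M ∷ K ∷ []))
    sound : ∀ {i j x} → chop C (1ℤ - M) M i j ≡ [ x ] →
            ∃[ q ] δ i j ≡ [ + q * (K + K) + K + x ] × 1ℤ - M ≤ x × x ≤ M
    sound {i} {j} {x} e with chop-inv (C i j) e
    ... | f , 1-M≤x , x≤M with finite? (δ i j)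
    ...   | inj₁ g = contradiction (C-⊤ g) (≡[]⇒≢⊤ f)
    ...   | inj₂ (d , g) with divide (δ-nonNegative g) 1≤2K
    ...     | q , r , refl , 0≤r , r<2K with clip-inv [ r - K ] (trans (sym (dC q g 0≤r r<2K)) f)
    -- An entry `- M` may stand for any smaller value; the lower end `1ℤ - M` of the chop removes
    -- it.
    ...       | _ , refl , inj₁ (_ , refl) = ⊥-elim (lin-⊥ 1-M≤x (solve (M ∷ [])))
    ...       | _ , refl , inj₂ (_ , _ , refl) = q , trans g (cong [_] (eq (+ q * (K + K)))) , 1-M≤x , x≤M
      where
      eq : ∀ b → b + r ≡ b + K + (r - K)
      eq b = solve (b ∷ r ∷ K ∷ [])
    exact : ∀ q {i j x} → δ i j ≡ [ + q * (K + K) + K + x ] → 1ℤ - M ≤ x → x ≤ M →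
            chop C (1ℤ - M) M i j ≡ [ x ]
    exact q {i} {j} {x} e 1-M≤x x≤M = trans
      (cong (chop∞ _ _) (trans C≡ (clip-mid (-M≤x 1-M≤x) x≤M))) (chop-mid 1-M≤x x≤M)
      where
      eq : K + x - K ≡ x
      eq = solve (K ∷ x ∷ [])
      C≡ : C i j ≡ clipᴹ [ x ]
      C≡ = trans (dC q (trans e (cong [_] (ℤ.+-assoc (+ q * (K + K)) K x)))
                   (lin (2M≤K ⊕ 1-M≤x ⊕ 0≤M ⊕ +≤+ (z≤n {1})) (solve (M ∷ K ∷ x ∷ [])))
                   (lin (2M≤K ⊕ x≤M ⊕ 1≤M) (solve (M ∷ K ∷ x ∷ []))))
                 (cong (λ y → clipᴹ [ y ]) eq)

  -- Even multiples of `N` come from `P` and odd ones from `Q`. Windows of `2M` offsets around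
  -- distinct multiples are disjoint as `2M ≤ N`, so the precedence of `P` never hides an entry of
  -- `Q`.
  Periodic-⋁ : ∀ {N P Q} → M + M ≤ N → Periodic (N + N) 0ℤ P → Periodic (N + N) N Q →
               Periodic N 0ℤ (P ⋁ Q)
  Periodic-⋁ {N} {P} {Q} 2M≤N pP pQ = record { sound = sound ; exact = exact }
    where
    even : ∀ h x → h * (N + N) + 0ℤ + x ≡ (h + h) * N + 0ℤ + x
    even h x = solve (h ∷ x ∷ N ∷ [])
    odd : ∀ h x → h * (N + N) + N + x ≡ (1ℤ + (h + h)) * N + 0ℤ + x
    odd h x = solve (h ∷ x ∷ N ∷ [])
    sound : ∀ {i j x} → (P ⋁ Q) i j ≡ [ x ] →
            ∃[ q ] δ i j ≡ [ + q * N + 0ℤ + x ] × 1ℤ - M ≤ x × x ≤ M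
    sound {i} {j} {x} e with P i j in f
    sound refl | [ x ] with Periodic.sound pP f
    ... | q , g , b = q ℕ.+ q , trans g (cong [_] (even (+ q) x)) , b
    sound {x = x} e | ⊤⁺ with Periodic.sound pQ e
    ... | q , g , b = suc (q ℕ.+ q) , trans g (cong [_] (odd (+ q) x)) , b
    0≤2N : 0ℤ ≤ N + N
    0≤2N = ℤ.≤-trans (0≤M ⊕ 0≤M ⊕ (0≤M ⊕ 0≤M)) (2M≤N ⊕ 2M≤N)
    disjoint : ∀ {i j x y} h → δ i j ≡ [ + h * (N + N) + N + x ] → 1ℤ - M ≤ x → x ≤ M → P i j ≢ [ y ]
    disjoint {x = x} {y} h e 1-M≤x x≤M f with Periodic.sound pP f
    ... | q , g , 1-M≤y , y≤M with []-unique e g | multiples-≤ {N + N} q h 0≤2N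
    ...   | eq | inj₁ q≤h = absurd {+ h * (N + N)} (ℤ.≤-reflexive eq) q≤h
      where
      absurd : ∀ {h q} → h + N + x ≤ q + 0ℤ + y → q ≤ h → ⊥
      absurd {h} {q} p r = lin-⊥ (p ⊕ r ⊕ 1-M≤x ⊕ y≤M ⊕ 2M≤N) (solve (h ∷ q ∷ x ∷ y ∷ N ∷ M ∷ []))
    ...   | eq | inj₂ h<q = absurd {+ h * (N + N)} (ℤ.≤-reflexive (sym eq)) h<q
      where
      absurd : ∀ {h q} → q + 0ℤ + y ≤ h + N + x → h + (N + N) ≤ q → ⊥
      absurd {h} {q} p r = lin-⊥ (p ⊕ r ⊕ 1-M≤y ⊕ x≤M ⊕ 2M≤N) (solve (h ∷ q ∷ x ∷ y ∷ N ∷ M ∷ []))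
    exact : ∀ q {i j x} → δ i j ≡ [ + q * N + 0ℤ + x ] → 1ℤ - M ≤ x → x ≤ M → (P ⋁ Q) i j ≡ [ x ]
    exact q {i} {j} {x} e 1-M≤x x≤M with even-or-odd q
    ... | h , inj₁ refl = cong (λ p → orElse {n} p (Q i j))
      (Periodic.exact pP h (trans e (cong [_] (sym (even (+ h) x)))) 1-M≤x x≤M)
    ... | h , inj₂ refl = trans
      (cong (λ p → orElse {n} p (Q i j)) (≢[]⇒≡⊤ (disjoint h e′ 1-M≤x x≤M)))
      (Periodic.exact pQ h e′ 1-M≤x x≤M)
      where
      e′ : δ i j ≡ [ + h * (N + N) + N + x ]
      e′ = trans e (cong [_] (sym (odd (+ h) x)))

-- The rounded logarithm and a sum by its last term

n≤2*⌈n/2⌉ : ∀ n → n ℕ.≤ 2 ℕ.* ⌈ n /2⌉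
n≤2*⌈n/2⌉ zero          = z≤n
n≤2*⌈n/2⌉ (suc zero)    = s≤s z≤n
n≤2*⌈n/2⌉ (suc (suc n)) = subst (suc (suc n) ℕ.≤_) (sym (ℕ.*-suc 2 ⌈ n /2⌉)) (s≤s (s≤s (n≤2*⌈n/2⌉ n)))

-- The recursion follows the accessibility proof over which `⌈log2⌉` is defined, halving upwards at
-- each step.
n≤2^⌈log₂n⌉ : ∀ n → n ℕ.≤ 2 ^ ⌈log₂ n ⌉
n≤2^⌈log₂n⌉ n = go n (<-wellFounded n)
  where
  go : ∀ n (a : Acc ℕ._<_ n) → n ℕ.≤ 2 ^ ⌈log2⌉ n a
  go 0 _ = z≤n
  go 1 _ = s≤s z≤n
  go (suc (suc n)) (acc rs) =
    ℕ.≤-trans (n≤2*⌈n/2⌉ (suc (suc n))) (ℕ.*-monoʳ-≤ 2 (go (suc ⌈ n /2⌉) _))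

∑-last : ∀ (f : ℕ → ℤ) s → ∑[ t < suc s ] f (toℕ t) ≡ ∑[ t < s ] f (toℕ t) + f s
∑-last f zero    = ℤ.+-comm (f 0) 0ℤ
∑-last f (suc s) = trans (cong (_+_ (f 0)) (∑-last (λ t → f (suc t)) s)) (sym (ℤ.+-assoc (f 0) _ _))

-- The run of the algorithm

module Correctness {n} (G : Graph n) (m : ℕ)
         (bounds : ∀ {i j} → Graph.Edge G i j → 1ℤ ≤ Graph.cost G i j × Graph.cost G i j ≤ + (2 ^ m))
         where

  open Graph G
  open ShoshanZwick m costMatrix

  1≤M : 1ℤ ≤ M
  1≤M = +≤+ (ℕ.m^n>0 2 m)

  open Iteration G M 1≤M bounds

  -- Scales, and the matrices `D` and `A k`

  scale : ℕ → ℤ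
  scale k = + (2 ^ k) * M

  scale-suc : ∀ k → scale (suc k) ≡ scale k + scale k
  scale-suc k = trans (cong (λ x → (+ (2 ^ k) + + x) * M) (ℕ.+-identityʳ (2 ^ k)))
                      (ℤ.*-distribʳ-+ M (+ (2 ^ k)) (+ (2 ^ k)))

  M≤scale : ∀ k → M ≤ scale k
  M≤scale k = subst (_≤ scale k) (ℤ.*-identityˡ M) (ℤ.*-monoʳ-≤-nonNeg M {1ℤ} (+≤+ (ℕ.m^n>0 2 k)))

  2M≤scale : ∀ k → M + M ≤ scale (suc k)
  2M≤scale k = subst (M + M ≤_) (sym (scale-suc k)) (M≤scale k ⊕ M≤scale k)

  2M≡ : + 2 * M ≡ + (2 ^ suc m)
  2M≡ = sym (ℤ.pos-* 2 (2 ^ m))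

  D-inv : ∀ {i j c} → D i j ≡ [ c ] → δ i j ≡ [ c ] × c ≤ + 2 * M
  D-inv = squaring-inv m 2M≡

  D-δ : ∀ {i j d} → δ i j ≡ [ d ] → d ≤ + 2 * M → D i j ≡ [ d ]
  D-δ = squaring-δ (suc m) 2M≡

  D-⊤ : ∀ {i j} → δ i j ≡ ⊤⁺ → D i j ≡ ⊤⁺
  D-⊤ e = ≢[]⇒≡⊤ λ f → ≡[]⇒≢⊤ (proj₁ (D-inv f)) e

  -- `D` agrees with δ up to `2M` and is infinite beyond, so subtracting `M` yields the clipped
  -- shift for `k = 0`; each squaring doubles the scale.
  Shifted-A : ∀ k → Shifted (scale k) (A k)
  Shifted-A zero = subst (λ K → Shifted K (A 0)) (sym (ℤ.*-identityˡ M))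
    (record { finite = finite ; infinite = infinite })
    where
    lower : ∀ M d → d - M - - M ≡ d - 0ℤ
    lower M d = solve (M ∷ d ∷ [])
    upper : ∀ M d → M - (d - M) ≡ + 2 * M - d
    upper M d = solve (M ∷ d ∷ [])
    above : ∀ M d → d - M - (1ℤ + M) ≡ d - (1ℤ + + 2 * M)
    above M d = solve (M ∷ d ∷ [])
    finite : ∀ {i j d} → δ i j ≡ [ d ] → A 0 i j ≡ clipᴹ [ d - M ]
    finite {d = d} e with ≤-cases d (+ 2 * M)
    ... | inj₁ d≤2M = trans (cong (_+∞ [ - M ]) (D-δ e d≤2M))
                            (sym (clip-mid (lin (δ-nonNegative e) (lower M d)) (lin d≤2M (upper M d))))
    ... | inj₂ 2M<d = trans (cong (_+∞ [ - M ]) (≢[]⇒≡⊤ λ f → suc≤⇒≰ 2M<d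
                              (subst (_≤ + 2 * M) ([]-unique (proj₁ (D-inv f)) e) (proj₂ (D-inv f)))))
                            (sym (clip-> {x = d - M} (-M≤M 1≤M) (lin 2M<d (above M d))))
    infinite : ∀ {i j} → δ i j ≡ ⊤⁺ → A 0 i j ≡ ⊤⁺
    infinite e = cong (_+∞ [ - M ]) (D-⊤ e)
  Shifted-A (suc k) = subst (λ K → Shifted K (A (suc k))) (sym (scale-suc k)) (Shifted-⋆ (M≤scale k) (Shifted-A k))

  δ+M≤scale-l : ∀ {i j d} → δ i j ≡ [ d ] → d + M ≤ scale l
  δ+M≤scale-l e = ℤ.≤-trans (δ-bound e) (ℤ.*-monoʳ-≤-nonNeg M (+≤+ (n≤2^⌈log₂n⌉ n)))

  -- The invariant of the descending loop

  period : ℕ → ℤ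
  period k = scale k + scale k

  -- The claims on `Q` and `C` rest on `M + M ≤ scale k`, which fails at `k = 0`, where `scale k` is
  -- `M`. At that index the output reads only `P`.
  record Invariant (k : ℕ) (s : State) : Set where
    field
      P-periodic : Periodic (period k) 0ℤ (State.P s)
      Q-periodic : 1 ℕ.≤ k → Periodic (period k) (scale k) (State.Q s)
      C-digit    : 1 ℕ.≤ k → Digit (scale k) (State.C s)

  private
    0≤period : ∀ k → 0ℤ ≤ period k
    0≤period k = ℤ.≤-trans 0≤M (M≤scale k) ⊕ ℤ.≤-trans 0≤M (M≤scale k)

  -- Every distance is at most `scale l - M`. Hence only the quotient 0 occurs, no distance enters
  -- the window around `scale l`, and every shifted remainder clips to `- M`.
  invariant-initial : Invariant l initial
  invariant-initial = record
    { P-periodic = record { sound = P-sound ; exact = P-exact }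
    ; Q-periodic = λ _ → record
      { sound = λ ()
      ; exact = λ q e 1-M≤x _ → ⊥-elim (Q-exact (scale l) M (0≤base q) (δ+M≤scale-l e) 1-M≤x)
      }
    ; C-digit    = λ _ q {r = r} e _ _ →
        sym (clip-≤ (-M≤M 1≤M) (C-bound (scale l) M r (0≤base q) (δ+M≤scale-l e)))
    }
    where
    0≤base : ∀ q → 0ℤ ≤ + q * period l
    0≤base q = 0≤multiple q (0≤period l)
    slack₀ : ∀ M → 0ℤ - (1ℤ - M) ≡ M - 1ℤ
    slack₀ M = solve (M ∷ [])
    slack₁ : ∀ M y → y - (1ℤ - M) ≡ y + M - (0ℤ + 1ℤ)
    slack₁ M y = solve (M ∷ y ∷ [])
    slack₂ : ∀ M → + 2 * M - M ≡ M - 0ℤ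
    slack₂ M = solve (M ∷ [])
    P-sound : ∀ {i j x} → clip D 0ℤ M i j ≡ [ x ] →
              ∃[ q ] δ i j ≡ [ + q * period l + 0ℤ + x ] × 1ℤ - M ≤ x × x ≤ M
    P-sound {i} {j} e with clip-inv (D i j) e
    ... | y , f , inj₁ (y≤0 , refl) with ℤ.≤-antisym y≤0 (δ-nonNegative (proj₁ (D-inv f)))
    ...   | refl = 0 , proj₁ (D-inv f) , lin 1≤M (slack₀ M) , 0≤M
    P-sound {i} {j} e | y , f , inj₂ (0≤y , y≤M , refl) =
      0 , trans (proj₁ (D-inv f)) (cong [_] (sym (ℤ.+-identityˡ y))) ,
      lin (0≤y ⊕ 1≤M) (slack₁ M y) , y≤M
    far : ∀ b K M x → 0ℤ ≤ K → 0ℤ ≤ b → b + (K + K) + 0ℤ + x + M ≤ K → 1ℤ - M ≤ x → ⊥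
    far b K M x 0≤K 0≤b d+M≤K 1-M≤x =
      lin-⊥ (0≤K ⊕ 0≤b ⊕ d+M≤K ⊕ 1-M≤x) (solve (b ∷ K ∷ M ∷ x ∷ []))
    P-exact : ∀ q {i j x} → δ i j ≡ [ + q * period l + 0ℤ + x ] → 1ℤ - M ≤ x → x ≤ M →
              clip D 0ℤ M i j ≡ [ x ]
    P-exact zero {i} {j} {x} e _ x≤M = trans
      (cong (clip∞ 0ℤ M) (D-δ e′ (ℤ.≤-trans x≤M (lin 0≤M (slack₂ M)))))
      (clip-mid (δ-nonNegative e′) x≤M)
      where
      e′ : δ i j ≡ [ x ]
      e′ = trans e (cong [_] (ℤ.+-identityˡ x))
    P-exact (suc q) {x = x} e 1-M≤x _ = ⊥-elim
      (far (+ q * period l) (scale l) M x (ℤ.≤-trans 0≤M (M≤scale l)) (0≤base q)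
        (subst (λ b → b + 0ℤ + x + M ≤ scale l) (suc-* (+ q) (period l)) (δ+M≤scale-l e)) 1-M≤x)
    Q-exact : ∀ {b x} K M → 0ℤ ≤ b → b + K + x + M ≤ K → 1ℤ - M ≤ x → ⊥
    Q-exact {b} {x} K M 0≤b d+M≤K 1-M≤x =
      lin-⊥ (0≤b ⊕ d+M≤K ⊕ 1-M≤x) (solve (b ∷ x ∷ K ∷ M ∷ []))
    C-bound : ∀ {b} K M r → 0ℤ ≤ b → b + r + M ≤ K → r - K ≤ - M
    C-bound {b} K M r 0≤b d+M≤K = lin (0≤b ⊕ d+M≤K) (solve (b ∷ r ∷ K ∷ M ∷ []))

  invariant-step : ∀ k {s} → Invariant (suc k) s → Invariant k (step k s)
  invariant-step k {state C P Q} I = record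
    { P-periodic = Periodic-⋁ 2M≤N pP pQ
    ; Q-periodic = λ { (s≤s {n = j} _) → Periodic-chop (2M≤scale j)
                         (Digit-step (2M≤scale j) (Shifted-A k) dC pP pQ)
                         (infinite-step (2M≤scale j) (Shifted-A k) dC pP pQ) }
    ; C-digit    = λ { (s≤s {n = j} _) → Digit-step (2M≤scale j) (Shifted-A k) dC pP pQ }
    }
    where
    2M≤N : M + M ≤ period k
    2M≤N = M≤scale k ⊕ M≤scale k
    pP : Periodic (period k + period k) 0ℤ P
    pP = subst (λ K → Periodic (K + K) 0ℤ P) (scale-suc k) (Invariant.P-periodic I)
    pQ : Periodic (period k + period k) (period k) Q
    pQ = subst (λ K → Periodic (K + K) K Q) (scale-suc k) (Invariant.Q-periodic I (s≤s z≤n))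
    dC : Digit (period k) C
    dC = subst (λ K → Digit K C) (scale-suc k) (Invariant.C-digit I (s≤s z≤n))

  invariant : ∀ t → t ℕ.≤ l → Invariant (l ∸ t) (after t)
  invariant zero    _   = invariant-initial
  invariant (suc t) t<l = invariant-step (l ∸ suc t)
    -- `l ∸ t` is rewritten as `suc (l ∸ suc t)`, the index at which the next round starts.
    (subst (λ k → Invariant k (after t)) (ℕ.+-∸-assoc 1 t<l) (invariant t (ℕ.<⇒≤ t<l)))

  invariant-at : ∀ k → k ℕ.≤ l → Invariant k (after (l ∸ k))
  invariant-at k k≤l = subst (λ k′ → Invariant k′ (after (l ∸ k))) (ℕ.m∸[m∸n]≡n k≤l)
    (invariant (l ∸ k) (ℕ.m∸n≤m l k))

  -- Reassembling the distance from its digits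

  term : Fin n → Fin n → ℕ → ℤ
  term i j t = + (2 ^ suc t) * B (suc t) i j

  digits : Fin n → Fin n → ℕ → ℤ
  digits i j s = ∑[ t < s ] term i j (toℕ t)

  Remainder : ℤ → ℕ → ℤ → Set
  Remainder d k r = ∃[ q ] d ≡ + q * period k + r × 0ℤ ≤ r × 1ℤ + r ≤ period k

  module _ {i j d} (e : δ i j ≡ [ d ]) {k} (k≤l : k ℕ.≤ l) (1≤k : 1 ℕ.≤ k) {r : ℤ} where

    private
      C-digit : Remainder d k r → C k i j ≡ clipᴹ [ r - scale k ]
      C-digit (q , d≡ , 0≤r , r<2K) =
        Invariant.C-digit (invariant-at k k≤l) 1≤k q (trans e (cong [_] d≡)) 0≤r r<2K

    B≡0 : Remainder d k r → 1ℤ + r ≤ scale k → B k i j ≡ 0ℤ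
    B≡0 R r<K with clip-negative 1≤M {r - scale k} (lin r<K (slack r (scale k)))
      where
      slack : ∀ r K → 0ℤ - (1ℤ + (r - K)) ≡ K - (1ℤ + r)
      slack r K = solve (r ∷ K ∷ [])
    ... | c , f , c<0 rewrite trans (C-digit R) f | dec-false (0ℤ ℤ.≤? c) (suc≤⇒≰ c<0) = refl

    B≡1 : Remainder d k r → scale k ≤ r → B k i j ≡ 1ℤ
    B≡1 R K≤r = trans
      (cong (λ x → if does ([ 0ℤ ] ≤? x) then 1ℤ else 0ℤ) (C-digit R))
      (cong (if_then 1ℤ else 0ℤ) (proj₁ (clip-nonNegative 1≤M {r - scale k} (ℤ.i≤j⇒0≤j-i K≤r))))

  module _ {i j d} (e : δ i j ≡ [ d ]) {r} (R₀ : Remainder d 0 r) where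

    -- Passing from modulus `period s` to its double adds `period s` exactly when the quotient is
    -- odd. As `scale (suc s)` equals `period s`, this parity is what `B (suc s)` reads off.
    digits-remainder : ∀ s → s ℕ.≤ l → Remainder d s (r + M * digits i j s)
    digits-remainder zero    _   = subst (Remainder d 0) (sym r≡) R₀
      where
      r≡ : r + M * 0ℤ ≡ r
      r≡ = trans (cong (_+_ r) (ℤ.*-zeroʳ M)) (ℤ.+-identityʳ r)
    digits-remainder (suc s) s<l with digits-remainder s (ℕ.<⇒≤ s<l)
    ... | p , d≡ , 0≤R , R<2K = go (even-or-odd p)
      where
      K R : ℤ
      K = scale (suc s)
      R = r + M * digits i j s
      K≡ : K ≡ period s
      K≡ = scale-suc s
      0≤K : 0ℤ ≤ K
      0≤K = ℤ.≤-trans 0≤M (M≤scale (suc s))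
      R<K : 1ℤ + R ≤ K
      R<K = subst (1ℤ + R ≤_) (sym K≡) R<2K
      next : ∀ {b} → B (suc s) i j ≡ b → r + M * digits i j (suc s) ≡ R + b * K
      next {b} B≡ = trans
        (cong (λ x → r + M * x) (trans (∑-last (term i j) s)
          (cong (λ b → digits i j s + + (2 ^ suc s) * b) B≡)))
        (expand r M (digits i j s) (+ (2 ^ suc s)) b)
        where
        expand : ∀ r M D P b → r + M * (D + P * b) ≡ r + M * D + b * (P * M)
        expand r M D P b = solve (r ∷ M ∷ D ∷ P ∷ b ∷ [])
      even : ∀ h L R → (h + h) * L + R ≡ h * (L + L) + R
      even h L R = solve (h ∷ L ∷ R ∷ [])
      odd : ∀ h L R → (1ℤ + (h + h)) * L + R ≡ h * (L + L) + (R + L)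
      odd h L R = solve (h ∷ L ∷ R ∷ [])
      slack₀ : ∀ R K → K + K - (1ℤ + R) ≡ K + K - (1ℤ + R + 0ℤ)
      slack₀ R K = solve (R ∷ K ∷ [])
      slack₁ : ∀ R K → K + K - (1ℤ + (R + K)) ≡ K - (1ℤ + R)
      slack₁ R K = solve (R ∷ K ∷ [])
      slack₂ : ∀ R K → R + K - K ≡ R - 0ℤ
      slack₂ R K = solve (R ∷ K ∷ [])
      go : ∃[ h ] (p ≡ h ℕ.+ h ⊎ p ≡ suc (h ℕ.+ h)) →
           Remainder d (suc s) (r + M * digits i j (suc s))
      go (h , inj₁ refl) = subst (Remainder d (suc s))
        (sym (trans (next (B≡0 e s<l (s≤s z≤n) R′ R<K)) (ℤ.+-identityʳ R))) R′
        where
        R′ : Remainder d (suc s) R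
        R′ = h ,
          trans d≡ (trans (even (+ h) (period s) R) (cong (λ x → + h * (x + x) + R) (sym K≡))) ,
          0≤R , lin (R<K ⊕ 0≤K) (slack₀ R K)
      go (h , inj₂ refl) = subst (Remainder d (suc s))
        (sym (trans (next (B≡1 e s<l (s≤s z≤n) R′ (lin 0≤R (slack₂ R K))))
                    (cong (_+_ R) (ℤ.*-identityˡ K)))) R′
        where
        R′ : Remainder d (suc s) (R + K)
        R′ = h ,
          trans d≡ (trans (odd (+ h) (period s) R) (cong (λ x → + h * (x + x) + (R + x)) (sym K≡))) ,
          0≤R ⊕ 0≤K , lin R<K (slack₁ R K)

    -- At `s = l` the modulus exceeds every distance, so the quotient is zero and the remainder is
    -- `d`.
    digits-sum : d ≡ r + M * digits i j l
    digits-sum with digits-remainder l ℕ.≤-refl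
    ... | zero  , d≡ , _       = trans d≡ (ℤ.+-identityˡ _)
    ... | suc p , d≡ , 0≤R , _ = ⊥-elim
      (far (+ p * period l) (scale l) R (0≤multiple p (0≤period l)) 0≤R
           (ℤ.≤-trans 0≤M (M≤scale l))
           (subst (λ x → x + M ≤ scale l) (trans d≡ (cong (_+ R) (suc-* (+ p) (period l))))
                  (δ+M≤scale-l e)))
      where
      R : ℤ
      R = r + M * digits i j l
      far : ∀ b K R → 0ℤ ≤ b → 0ℤ ≤ R → 0ℤ ≤ K → b + (K + K) + R + M ≤ K → ⊥
      far b K R 0≤b 0≤R 0≤K h = far′ M 1≤M h
        where
        far′ : ∀ M → 1ℤ ≤ M → b + (K + K) + R + M ≤ K → ⊥
        far′ M 1≤M h = lin-⊥ (0≤b ⊕ 0≤R ⊕ h ⊕ 0≤K ⊕ 1≤M) (solve (b ∷ K ∷ M ∷ R ∷ []))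

    period-0 : period 0 ≡ M + M
    period-0 = cong₂ _+_ (ℤ.*-identityˡ M) (ℤ.*-identityˡ M)

    P₀-exact : ∀ q {x} → d ≡ + q * (M + M) + x → 1ℤ - M ≤ x → x ≤ M → P 0 i j ≡ [ x ]
    P₀-exact q {x} eq = Periodic.exact (Invariant.P-periodic (invariant-at 0 z≤n)) q
      (trans e (cong [_] (trans eq (cong (_+ x)
        (trans (cong (+ q *_) (sym period-0)) (sym (ℤ.+-identityʳ (+ q * period 0))))))))

    -- For `r ≤ M` the offset in `P 0` is `r`. Otherwise it is `r - 2M`, measured from the next
    -- multiple of `2M` and strictly between `- M` and 0; `B̂₀` detects this and restores `2M`.
    low-digit : [ + 2 * M * B̂₀ i j ] +∞ P 0 i j ≡ [ r ]
    low-digit = go (≤-cases r M)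
      where
      q : ℕ
      q = proj₁ R₀
      0≤r : 0ℤ ≤ r
      0≤r = proj₁ (proj₂ (proj₂ R₀))
      d≡ : d ≡ + q * (M + M) + r
      d≡ = trans (proj₁ (proj₂ R₀)) (cong (λ L → + q * L + r) period-0)
      r<2M : 1ℤ + r ≤ M + M
      r<2M = subst (1ℤ + r ≤_) period-0 (proj₂ (proj₂ (proj₂ R₀)))
      slack : ∀ M r → r - (1ℤ - M) ≡ r + M - (0ℤ + 1ℤ)
      slack M r = solve (M ∷ r ∷ [])
      carry : ∀ q M r → q * (M + M) + r ≡ (1ℤ + q) * (M + M) + (r - (M + M))
      carry q M r = solve (q ∷ M ∷ r ∷ [])
      slack₁ : ∀ M r → r - (M + M) - (1ℤ - M) ≡ r - (1ℤ + M)
      slack₁ M r = solve (M ∷ r ∷ [])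
      slack₂ : ∀ M r → M - (r - (M + M)) ≡ M + M + M + 1ℤ - (1ℤ + r + 0ℤ + 0ℤ)
      slack₂ M r = solve (M ∷ r ∷ [])
      slack₃ : ∀ M r → 0ℤ - (1ℤ + (r - (M + M))) ≡ M + M - (1ℤ + r)
      slack₃ M r = solve (M ∷ r ∷ [])
      slack₄ : ∀ M r → r - (M + M) - (1ℤ + - M) ≡ r - (1ℤ + M)
      slack₄ M r = solve (M ∷ r ∷ [])
      total : ∀ M r → + 2 * M * 1ℤ + (r - (M + M)) ≡ r
      total M r = solve (M ∷ r ∷ [])
      go : r ≤ M ⊎ 1ℤ + M ≤ r → [ + 2 * M * B̂₀ i j ] +∞ P 0 i j ≡ [ r ]
      go (inj₁ r≤M)
        rewrite P₀-exact q d≡ (lin (0≤r ⊕ 1≤M) (slack M r)) r≤M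
              | dec-false (r ℤ.<? 0ℤ) (ℤ.≤⇒≯ 0≤r)
              | ∧-zeroʳ (does (- M ℤ.<? r)) =
        cong [_] (trans (cong (_+ r) (ℤ.*-zeroʳ (+ 2 * M))) (ℤ.+-identityˡ r))
      go (inj₂ M<r)
        rewrite P₀-exact (suc q) {r - (M + M)} (trans d≡ (carry (+ q) M r)) (lin M<r (slack₁ M r))
                         (lin (r<2M ⊕ 0≤M ⊕ +≤+ (z≤n {1})) (slack₂ M r))
              | dec-true (r - (M + M) ℤ.<? 0ℤ) (ℤ.suc[i]≤j⇒i<j (lin r<2M (slack₃ M r)))
              | dec-true (- M ℤ.<? r - (M + M)) (ℤ.suc[i]≤j⇒i<j (lin M<r (slack₄ M r))) =
        cong [_] (total M r)

  +∞-assoc-[] : ∀ a b x {r} → [ b ] +∞ x ≡ [ r ] → [ a + b ] +∞ x ≡ [ a + r ]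
  +∞-assoc-[] a b [ x ] refl = cong [_] (ℤ.+-assoc a b x)

  Δ≡δ : ∀ i j → Δ i j ≡ δ i j
  Δ≡δ i j with finite? (δ i j)
  -- The digits carry no information here; the infinite entry of `P 0` absorbs them.
  ... | inj₁ e = trans (cong ([ M * digits i j l + + 2 * M * B̂₀ i j ] +∞_) P₀≡⊤) (sym e)
    where
    P₀≡⊤ : P 0 i j ≡ ⊤⁺
    P₀≡⊤ = ≢[]⇒≡⊤ λ f →
      let _ , f′ , _ = Periodic.sound (Invariant.P-periodic (invariant-at 0 z≤n)) f
      in ≡[]⇒≢⊤ f′ e
  ... | inj₂ (d , e) with divide (δ-nonNegative e) 1≤period-0
    where
    slack : ∀ K M → K + K - 1ℤ ≡ K + K + M + M - (M + M + 1ℤ + 0ℤ)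
    slack K M = solve (K ∷ M ∷ [])
    1≤period-0 : 1ℤ ≤ period 0
    1≤period-0 = lin (M≤scale 0 ⊕ M≤scale 0 ⊕ 1≤M ⊕ 0≤M) (slack (scale 0) M)
  ...   | q , r , R = begin
    Δ i j                     ≡⟨ P₀+B̂₀ ⟩
    [ M * digits i j l + r ]  ≡⟨ cong [_] (ℤ.+-comm _ r) ⟩
    [ r + M * digits i j l ]  ≡⟨ cong [_] (digits-sum e (q , R)) ⟨
    [ d ]                     ≡⟨ e ⟨
    δ i j                     ∎
    where
    open ≡-Reasoning
    P₀+B̂₀ : Δ i j ≡ [ M * digits i j l + r ]
    P₀+B̂₀ = +∞-assoc-[] (M * digits i j l) (+ 2 * M * B̂₀ i j) (P 0 i j) (low-digit e (q , R))

theorem5p1 :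
    (m : ℕ) → 1 ℕ.≤ m →
    (n : ℕ) → 1 ℕ.≤ n →
    (G : Graph n) → (let open Graph G) →
    (∀ {i j} → Edge i j → + 1 ≤ cost i j × cost i j ≤ + (2 ^ m)) →
    ∀ (i j : Fin n) → IsDistance i j (revisedShoshanZwick m costMatrix i j)
theorem5p1 m _ n _ G bounds i j = subst (IsDistance i j) (sym (Δ≡δ i j)) (δ-isDistance i j)
  where
  open Graph G
  open Correctness G m bounds
  open Iteration G (+ (2 ^ m)) 1≤M bounds
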